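{- Let $\mathcal{M}$ be any positroid, of rank $r$. Then its $h$-vector $(h_0,\dots,h_r)$ is a pure $O$-sequence.
   Context: **Le-diagrams.** Fix $n\ge k\ge 0$ and a Young diagram $\lambda$ (English notation, rows left-justified and weakly decreasing from top to bottom) contained in a $k\times(n-k)$ rectangle; rows and columns of length $0$ are allowed. The boundary path of $\lambda$ is the lattice path of $n$ unit steps from the northeast corner to the southwest corner of the rectangle following the southeastern boundary of $\lambda$. Label its steps $1,\dots,n$ in this order. Each row is indexed by the label of the vertical step at its right end, and each column by the label of the horizontal step at its bottom end (so row labels increase downward and column labels increase from right to left). The box in row $i$ and column $j$ is denoted $(i,j)$. A Le-diagram $L$ of shape $\lambda$ is a placement of dots in some of the boxes ($L_{i,j}=1$ if box $(i,j)$ has a dot, $L_{i,j}=0$ otherwise) such that for any three boxes $(i,j),(i',j),(i,j')$ of $\lambda$ with $i'<i$ and $j'>j$, if $L_{i',j}=L_{i,j'}=1$ then $L_{i,j}=1$. **Le-graph.** Place a boundary vertex labeled $m$ in the middle of the $m$-th step of the boundary path, $m=1,\dots,n$. The vertices of the Le-graph are the boundary vertices and the dots of $L$. From each dot draw a horizontal edge to its right and a vertical edge downward, each until it reaches the next dot in that row (column) or, if there is none, the boundary vertex of that row (column). Orient horizontal edges to the left and vertical edges downward. The boundary vertices on vertical steps (row labels) are the sources, those on horizontal steps (column labels) are the sinks. Let $B_0\subseteq[n]$ be the set of sources. A path is a directed path with at least one edge starting and ending at boundary vertices (hence from a source to a sink). A family of non-touching paths is a (possibly empty) finite family of pairwise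 vertex-disjoint paths. A family $p_1,\dots,p_m$, with $p_i$ going from source $s_i$ to sink $k_i$, represents the set $(B_0\setminus\{s_1,\dots,s_m\})\cup\{k_1,\dots,k_m\}$. **Positroid.** The positroid $\mathcal{M}_L$ is the matroid on the ground set $[n]=\{1,\dots,n\}$ whose bases are exactly the sets represented by families of non-touching paths in the Le-graph of $L$. A positroid is a matroid of the form $\mathcal{M}_L$ for some Le-diagram $L$. **$h$-vector.** For a matroid of rank $r$ on a totally ordered ground set, an element $i$ of a basis $B$ is passive if $(B\setminus\{i\})\cup\{j\}$ is a basis for some $j<i$. The $h$-vector is $(h_0,\dots,h_r)$ where $h_i$ is the number of bases having exactly $i$ passive elements. (This does not depend on the chosen order.) **Pure $O$-sequences.** An order ideal is a finite nonempty collection $X$ of monomials such that if $M\in X$ and $N$ divides $M$ then $N\in X$. Its $O$-sequence is $(f_0,\dots,f_d)$, where $f_i$ is the number of monomials of degree $i$ in $X$ and $d$ is the maximal degree in $X$. It is pure if all elements of $X$ that are maximal under divisibility have the same degree. A pure $O$-sequence is the $O$-sequence of a pure order ideal. Sequences are considered up to trailing zeros (so that deleting a loop or contracting a coloop does not change the $h$-vector). -}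

module Defs where

open import Data.Bool.Base using (Bool; T)
open import Data.Fin.Base as Fin using (Fin; toℕ; fromℕ<)
open import Data.Fin.Properties using (toℕ<n; any?) renaming (_<?_ to _<ᶠ?_)
open import Data.Fin.Subset
  using (Subset; inside; outside; _∈_; _∉_; _∪_; _─_; _-_; ⁅_⁆; ⋃; ∣_∣)
open import Data.Fin.Subset.Properties using (_∈?_)
open import Data.List.Base
  using (List; []; _∷_; _++_; map; filter; length; foldr; allFin; applyUpTo; replicate)
import Data.List.Membership.Propositional as List
open import Data.List.Properties using (length-filter; length-tabulate)
open import Data.List.Relation.Binary.Disjoint.Propositional using (Disjoint)
open import Data.List.Relation.Unary.AllPairs using (AllPairs)
open import Data.List.Relation.Unary.Unique.Propositional using (Unique)
open import Data.Nat.Base using (ℕ; suc; z≤n; s≤s; _+_; _∸_; _⊔_; _≤_; _<_)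
open import Data.Nat.Properties
  using (_≟_; _<?_; ≤-trans; ≤-reflexive; +-mono-<-≤; +-mono-≤-<; m∸n≤m; m∸n+n≡m; ∸-monoʳ-<)
open import Data.Product.Base using (Σ-syntax; ∃; ∃-syntax; _×_; proj₁)
open import Data.Vec.Base as Vec using (Vec)
open import Data.Vec.Relation.Binary.Pointwise.Inductive using (Pointwise)
open import Function.Base using (id)
open import Function.Bundles using (_⇔_)
open import Level using (0ℓ)
open import Relation.Binary.Construct.Closure.Transitive using (TransClosure; [_]; _∷_)
open import Relation.Binary.PropositionalEquality using (_≡_; _≢_)
open import Relation.Nullary.Decidable using (_×-dec_)
open import Relation.Nullary.Negation using (¬_)
open import Relation.Unary using (Pred; Decidable)

------------------------------------------------------------------------
-- Le-diagrams

-- A Young diagram inside a k × (n ∸ k) rectangle.  Rows are numbered from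
-- the top and columns from the left, both starting at 0; these numbers are
-- positions in the rectangle, not the labels of rows and columns below.
record YoungDiagram (n : ℕ) : Set where
  field
    k          : ℕ
    k≤n        : k ≤ n
    rowLength  : Fin k → ℕ
    bounded    : ∀ r → rowLength r ≤ n ∸ k
    decreasing : ∀ {r r′} → r Fin.≤ r′ → rowLength r′ ≤ rowLength r

  Row Col : Set
  Row = Fin k
  Col = Fin (n ∸ k)

  Box : Row → Col → Set
  Box r c = toℕ c < rowLength r

  colLength : Col → ℕ
  colLength c = length (filter (λ r → toℕ c <? rowLength r) (allFin k))

  private
    colLength≤k : ∀ c → colLength c ≤ k
    colLength≤k c = ≤-trans (length-filter _ (allFin k))
                            (≤-reflexive (length-tabulate {n = k} id))

  -- The steps of the boundary path, numbered 0, …, n - 1 from the northeast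
  -- corner (so the element m of Fin n stands for the label m + 1).  The
  -- number of a step is the number of steps preceding it: the vertical step
  -- at the end of row r comes after r vertical and (n ∸ k) ∸ rowLength r
  -- horizontal steps, and the horizontal step at the bottom of column c
  -- comes after the horizontal steps of the (n ∸ k) ∸ suc c columns to its
  -- right and the vertical steps of the colLength c rows meeting column c.
  rowLabel : Row → Fin n
  rowLabel r = fromℕ< {((n ∸ k) ∸ rowLength r) + toℕ r}
    (≤-trans (+-mono-≤-< (m∸n≤m (n ∸ k) (rowLength r)) (toℕ<n r))
             (≤-reflexive (m∸n+n≡m k≤n)))

  colLabel : Col → Fin n
  colLabel c = fromℕ< {((n ∸ k) ∸ suc (toℕ c)) + colLength c}
    (≤-trans (+-mono-<-≤ (∸-monoʳ-< {n ∸ k} (s≤s z≤n) (toℕ<n c))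
                         (colLength≤k c))
             (≤-reflexive (m∸n+n≡m k≤n)))

-- In the condition `le` the box (r , c′) is to the left of (r , c), i.e. the
-- label of its column is the larger one.
record LeDiagram (n : ℕ) : Set where
  field
    shape : YoungDiagram n
  open YoungDiagram shape public
  field
    filling : Row → Col → Bool

  Dot : Row → Col → Set
  Dot r c = T (filling r c)

  field
    dot⇒box : ∀ {r c} → Dot r c → Box r c
    le      : ∀ {r r′ c c′} → Box r c → Box r′ c → Box r c′ →
              r′ Fin.< r → c′ Fin.< c →
              Dot r′ c → Dot r c′ → Dot r c

------------------------------------------------------------------------
-- Le-graphs

setOf : ∀ {n} → List (Fin n) → Subset n
setOf xs = ⋃ (map ⁅_⁆ xs)

module LeGraph {n : ℕ} (L : LeDiagram n) where
  open LeDiagram L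

  data Vertex : Set where
    boundary : Fin n → Vertex
    dot      : ∀ r c → Dot r c → Vertex

  infix 4 _⟶_

  data _⟶_ : Vertex → Vertex → Set where
    enter : ∀ {r c} (d : Dot r c) →
            (∀ {c″} → c Fin.< c″ → ¬ Dot r c″) →
            boundary (rowLabel r) ⟶ dot r c d
    left  : ∀ {r c c′} (d : Dot r c) (d′ : Dot r c′) → c Fin.< c′ →
            (∀ {c″} → c Fin.< c″ → c″ Fin.< c′ → ¬ Dot r c″) →
            dot r c′ d′ ⟶ dot r c d
    down  : ∀ {r r′ c} (d : Dot r c) (d′ : Dot r′ c) → r Fin.< r′ →
            (∀ {r″} → r Fin.< r″ → r″ Fin.< r′ → ¬ Dot r″ c) →
            dot r c d ⟶ dot r′ c d′
    exit  : ∀ {r c} (d : Dot r c) →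
            (∀ {r″} → r Fin.< r″ → ¬ Dot r″ c) →
            dot r c d ⟶ boundary (colLabel c)

  B₀ : Subset n
  B₀ = setOf (map rowLabel (allFin k))

  -- The graph is acyclic, so a walk never repeats a vertex.
  record Path : Set where
    field
      start end : Fin n
      edges     : TransClosure _⟶_ (boundary start) (boundary end)

  open Path public

  visited : ∀ {u v} → TransClosure _⟶_ u v → List Vertex
  visited {u} {v} [ _ ] = u ∷ v ∷ []
  visited {u} (_ ∷ es)  = u ∷ visited es

  vertices : Path → List Vertex
  vertices p = visited (edges p)

  NonTouching : List Path → Set
  NonTouching = AllPairs (λ p q → Disjoint (vertices p) (vertices q))

  represented : List Path → Subset n
  represented ps = (B₀ ─ setOf (map start ps)) ∪ setOf (map end ps)

  Represented : Subset n → Set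
  Represented B = ∃[ ps ] NonTouching ps × B ≡ represented ps

------------------------------------------------------------------------
-- Matroids and positroids

record Matroid (n : ℕ) : Set₁ where
  field
    Basis    : Pred (Subset n) 0ℓ
    basis?   : Decidable Basis
    nonempty : ∃ Basis
    exchange : ∀ {A B x} → Basis A → Basis B → x ∈ A → x ∉ B →
               ∃[ y ] y ∈ B × y ∉ A × Basis ((A - x) ∪ ⁅ y ⁆)

  -- By `exchange` all bases have the same size.
  rank : ℕ
  rank = ∣ proj₁ nonempty ∣

IsPositroid : ∀ {n} → Matroid n → Set
IsPositroid {n} M =
  Σ[ L ∈ LeDiagram n ] (∀ B → Matroid.Basis M B ⇔ LeGraph.Represented L B)

------------------------------------------------------------------------
-- h-vectors

allSubsets : ∀ n → List (Subset n)
allSubsets 0       = Vec.[] ∷ []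
allSubsets (suc n) =
  map (outside Vec.∷_) (allSubsets n) ++ map (inside Vec.∷_) (allSubsets n)

module _ {n : ℕ} (M : Matroid n) where
  open Matroid M

  Passive : Subset n → Pred (Fin n) 0ℓ
  Passive B i = i ∈ B × ∃[ j ] j Fin.< i × Basis ((B - i) ∪ ⁅ j ⁆)

  passive? : ∀ B → Decidable (Passive B)
  passive? B i =
    i ∈? B ×-dec any? (λ j → j <ᶠ? i ×-dec basis? ((B - i) ∪ ⁅ j ⁆))

  passivity : Subset n → ℕ
  passivity B = length (filter (passive? B) (allFin n))

  h : ℕ → ℕ
  h i = length (filter (λ B → passivity B ≟ i) (filter basis? (allSubsets n)))

  hVector : List ℕ
  hVector = applyUpTo h (suc rank)

------------------------------------------------------------------------
-- Pure O-sequences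

-- Monomials in v variables, as exponent vectors.
Monomial : ℕ → Set
Monomial = Vec ℕ

degree : ∀ {v} → Monomial v → ℕ
degree = Vec.sum

_Divides_ : ∀ {v} → Monomial v → Monomial v → Set
_Divides_ = Pointwise _≤_

record OrderIdeal (v : ℕ) : Set where
  field
    monomials : List (Monomial v)
    unique    : Unique monomials
    nonempty  : monomials ≢ []
    closed    : ∀ {M N} → M List.∈ monomials → N Divides M → N List.∈ monomials

  Maximal : Monomial v → Set
  Maximal M = M List.∈ monomials ×
              (∀ {N} → N List.∈ monomials → M Divides N → N ≡ M)

  Pure : Set
  Pure = ∀ {M N} → Maximal M → Maximal N → degree M ≡ degree N

  maxDegree : ℕ
  maxDegree = foldr _⊔_ 0 (map degree monomials)

  f : ℕ → ℕ
  f i = length (filter (λ M → degree M ≟ i) monomials)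

  oSequence : List ℕ
  oSequence = applyUpTo f (suc maxDegree)

infix 4 _≈₀_

-- Equality up to trailing zeros.
_≈₀_ : List ℕ → List ℕ → Set
xs ≈₀ ys = ∃[ a ] ∃[ b ] xs ++ replicate a 0 ≡ ys ++ replicate b 0

IsPureOSequence : List ℕ → Set
IsPureOSequence xs =
  ∃[ v ] Σ[ X ∈ OrderIdeal v ] OrderIdeal.Pure X × xs ≈₀ OrderIdeal.oSequence X

{-# OPTIONS --safe #-}

-- Read a basis from its largest element downwards, keeping a stack of columns: a
-- column in the basis is pushed, a row outside the basis pops a column (its
-- partner), and a passive row in the basis is charged to the column on top.  The
-- monomial of the basis has one variable for each column, with exponent one plus
-- the number of rows charged to it (zero if the column is not in the basis).  Its
-- degree is the number of passive elements, and the basis can be decoded from it.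
--
-- As paths in a Le-graph cannot cross, partners are exactly the two ends of the
-- paths of a non-touching family.  Hence, if an element j of a basis is passive and
-- p is the partner of j (or of the column j is charged to), exchanging j for p
-- gives a basis again: either the path from p to j is removed, or the path starting
-- in p is replaced by the lower envelope with a path starting in j.
--
-- This implies that divisors of monomials of bases can be decoded too, by comparing
-- the two decodings step by step.  For purity, let m be an element of a basis f
-- that is neither passive nor a coloop, and let j be least such that f - m + j is
-- a basis.  Then the monomial of f properly divides that of f - m + j.  Therefore
-- the degree of a maximal monomial is the rank minus the number of coloops.

module Submission where

open import Defs
open import Data.Bool.Base using (Bool; true; false; T; not; _∧_)
open import Data.Bool.Properties using (T-irrelevant; T?) renaming (_≟_ to _≟ᵇ_)
open import Data.Empty using (⊥-elim)
open import Data.Fin.Base as Fin using (Fin; zero; suc; toℕ; fromℕ<; punchOut; splitAt)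
open import Data.Fin.Properties as Fin
  using (toℕ<n; toℕ-fromℕ<; fromℕ<-toℕ; toℕ-injective; any?; punchOut-injective; injective⇒≤)
open import Data.Fin.Subset
  using (Subset; inside; outside; _∈_; _∉_; _∪_; _─_; _-_; ⁅_⁆; ∣_∣)
open import Data.Fin.Subset.Properties
  using ( x∈p∪q⁺; x∈p∪q⁻; x∈⁅x⁆; x∈⁅y⁆⇒x≡y; ∉⊥; ⊆-antisym; x∈p∧x∉q⇒x∈p─q; p─q⊆p
        ; x∈p∧x≢y⇒x∈p-y; _∈?_)
open import Data.List.Base
  using ( List; []; _∷_; _++_; _ʳ++_; length; map; filter; foldr; tabulate; allFin; applyUpTo
        ; replicate)
open import Data.List.Membership.Propositional using () renaming (_∈_ to _∈ˡ_)
open import Data.List.Membership.Propositional.Properties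
  using (∈-map⁺; ∈-map⁻; ∈-++⁺ˡ; ∈-++⁺ʳ; ∈-++⁻; ∈-filter⁺; ∈-filter⁻; ∈-tabulate⁺)
open import Data.List.Properties
  using (∷-injective; ∷-injectiveʳ; ++-identityʳ; length-filter; length-tabulate; filter-none)
open import Data.List.Relation.Binary.Disjoint.Propositional using (Disjoint)
open import Data.List.Relation.Binary.Pointwise using ([]; _∷_) renaming (Pointwise to Pointwiseˡ)
open import Data.List.Relation.Binary.Subset.Propositional using (_⊆_)
open import Data.List.Relation.Unary.All as All using (All; []; _∷_)
import Data.List.Relation.Unary.All.Properties as All
open import Data.List.Relation.Unary.AllPairs as AllPairs using (AllPairs; []; _∷_)
open import Data.List.Relation.Unary.Any using (here; there)
open import Data.List.Relation.Unary.Unique.Propositional using (Unique)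
open import Data.List.Relation.Unary.Unique.Propositional.Properties using ()
  renaming (map⁺ to unique-map⁺; ++⁺ to unique-++⁺; filter⁺ to unique-filter⁺)
open import Data.Maybe.Base using (Maybe; just; nothing)
open import Data.Maybe.Properties using (just-injective)
open import Data.Nat.Base
  using (ℕ; zero; suc; _≤_; _<_; z≤n; s≤s; s≤s⁻¹; _+_; _∸_; _⊔_; _≡ᵇ_)
open import Data.Nat.ListAction using (sum)
open import Data.Nat.Properties
open import Algebra.Properties.CommutativeSemigroup +-commutativeSemigroup
  using (interchange; x∙yz≈y∙xz)
open import Data.Product.Base using (∃-syntax; Σ-syntax; _×_; _,_; proj₁; proj₂)
open import Data.Sum.Base using (_⊎_; inj₁; inj₂)
open import Data.Vec.Base as Vec using (Vec; []; _∷_; here; there)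
open import Data.Vec.Properties
  using ([]=⇒lookup; lookup⇒[]=; lookup∘tabulate; tabulate∘lookup; tabulate-cong)
  renaming (∷-injectiveʳ to ∷-injectiveʳᵛ)
open import Data.Vec.Relation.Binary.Pointwise.Inductive using (Pointwise; []; _∷_)
open import Function.Base using (_∘_; id)
open import Function.Bundles using (_⇔_; module Equivalence)
open import Relation.Binary.Construct.Closure.Transitive using (TransClosure; [_]; _∷_)
open import Relation.Binary.Definitions using (Tri; tri<; tri≈; tri>)
open import Relation.Binary.PropositionalEquality hiding ([_])
open import Relation.Nullary.Decidable using (Dec; yes; no; does; dec-true; map′; _×-dec_)
open import Relation.Nullary.Negation using (¬_; contradiction)
open import Relation.Unary using (Decidable)

-- A column comes with the set of (numbers of) rows having a dot in it.
data Step : Set where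
  row : ℕ → Step
  col : (ℕ → Bool) → Step

-- The Boolean tells whether the step belongs to the basis.  Words to the left
-- of a position (K below) have the largest label first, words to the right of
-- it (C below) the smallest one, so that C ʳ++ K is the whole word.  A stack
-- lists the rows along which paths run to the left, the lowest row first.
Letter Word Stack : Set
Letter = Step × Bool
Word   = List Letter
Stack  = List ℕ

-- By the Le-condition a row without a dot in a column that has a dot above it
-- is empty further left, so a path can only go straight on if no dot of the
-- column lies above its row.
data Move (D : ℕ → Bool) : ℕ → ℕ → Set where
  straight : ∀ {a} → (∀ {r} → r ≤ a → ¬ T (D r)) → Move D a a
  turn     : ∀ {a b} → a ≤ b → T (D a) → T (D b) → Move D a b

-- The bound makes every path leave the column above the row in which the next
-- lower path enters it.
data Cross (D : ℕ → Bool) : ℕ → Stack → Stack → Set where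
  []   : ∀ {u} → Cross D u [] []
  cons : ∀ {u a b A B} → b < u → Move D a b → Cross D a A B → Cross D u (a ∷ A) (b ∷ B)

data Run : Word → Stack → Set where
  []   : Run [] []
  stay : ∀ {r K O} → All (_< r) O → Run K O → Run ((row r , true) ∷ K) O
  push : ∀ {r K O} → All (_< r) O → Run K O → Run ((row r , false) ∷ K) (r ∷ O)
  pass : ∀ {D u K O O′} → Cross D u O O′ → Run K O → Run ((col D , false) ∷ K) O′
  exit : ∀ {D a K O O′} → T (D a) → Cross D a O O′ → Run K (a ∷ O) →
         Run ((col D , true) ∷ K) O′

data Rest : Word → Stack → Set where
  []   : Rest [] []
  stay : ∀ {r C O} → All (_< r) O → Rest C O → Rest ((row r , true) ∷ C) O
  push : ∀ {r C O} → All (_< r) O → Rest C (r ∷ O) → Rest ((row r , false) ∷ C) O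
  pass : ∀ {D u C O O′} → Cross D u O O′ → Rest C O′ → Rest ((col D , false) ∷ C) O
  exit : ∀ {D a C O O′} → T (D a) → Cross D a O O′ → Rest C O′ →
         Rest ((col D , true) ∷ C) (a ∷ O)

split : ∀ C {K} → Run (C ʳ++ K) [] → ∃[ O ] Run K O × Rest C O
split []      R = [] , R , []
split (l ∷ C) R with split C R
... | _ , stay o R′   , S = _ , R′ , stay o S
... | _ , push o R′   , S = _ , R′ , push o S
... | _ , pass t R′   , S = _ , R′ , pass t S
... | _ , exit d t R′ , S = _ , R′ , exit d t S

join : ∀ {C K O} → Run K O → Rest C O → Run (C ʳ++ K) []
join R []           = R
join R (stay o S)   = join (stay o R) S
join R (push o S)   = join (push o R) S
join R (pass t S)   = join (pass t R) S
join R (exit d t S) = join (exit d t R) S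

move-≤ : ∀ {D a b} → Move D a b → a ≤ b
move-≤ (straight _) = ≤-refl
move-≤ (turn p _ _) = p

cross-weaken : ∀ {D u v A B} → u ≤ v → Cross D u A B → Cross D v A B
cross-weaken p []           = []
cross-weaken p (cons q m t) = cons (<-≤-trans q p) m t

cross-length : ∀ {D u A B} → Cross D u A B → length A ≡ length B
cross-length []           = refl
cross-length (cons _ _ t) = cong suc (cross-length t)

rest-length : ∀ {C O O′} → Rest C O → Rest C O′ → length O ≡ length O′
rest-length [] [] = refl
rest-length (stay _ S) (stay _ S′) = rest-length S S′
rest-length (push _ S) (push _ S′) = suc-injective (rest-length S S′)
rest-length (pass t S) (pass t′ S′) =
  trans (cross-length t) (trans (rest-length S S′) (sym (cross-length t′)))
rest-length (exit _ t S) (exit _ t′ S′) =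
  cong suc (trans (cross-length t) (trans (rest-length S S′) (sym (cross-length t′))))

-- The height of a word is the number of paths running at its end.
data Height : Word → ℕ → Set where
  []    : Height [] 0
  stay  : ∀ {r K h} → Height K h → Height ((row r , true) ∷ K) h
  push  : ∀ {r K h} → Height K h → Height ((row r , false) ∷ K) (suc h)
  pass  : ∀ {D K h} → Height K h → Height ((col D , false) ∷ K) h
  exit  : ∀ {D K h} → Height K (suc h) → Height ((col D , true) ∷ K) h

run-height : ∀ {K O} → Run K O → Height K (length O)
run-height []           = []
run-height (stay _ R)   = stay (run-height R)
run-height (push _ R)   = push (run-height R)
run-height (pass t R)   = pass (subst (Height _) (cross-length t) (run-height R))
run-height (exit _ t R) = exit (subst (λ h → Height _ (suc h)) (cross-length t) (run-height R))

-- Removing paths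

-- The flags refer to the stack at the end of the word: a flagged path is removed
-- by putting the row where it starts into the basis.
dropPaths : Word → List Bool → Word
dropPaths []                       fs       = []
dropPaths ((row r , true) ∷ K)     fs       = (row r , true) ∷ dropPaths K fs
dropPaths ((row r , false) ∷ K)    []       = (row r , false) ∷ dropPaths K []
dropPaths ((row r , false) ∷ K)    (f ∷ fs) = (row r , f) ∷ dropPaths K fs
dropPaths ((col D , false) ∷ K)    fs       = (col D , false) ∷ dropPaths K fs
dropPaths ((col D , true) ∷ K)     fs       = (col D , true) ∷ dropPaths K (false ∷ fs)

dropRows : List Bool → Stack → Stack
dropRows []           O       = O
dropRows (f ∷ fs)     []      = []
dropRows (true ∷ fs)  (a ∷ O) = dropRows fs O
dropRows (false ∷ fs) (a ∷ O) = a ∷ dropRows fs O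

dropRows-[] : ∀ fs → dropRows fs [] ≡ []
dropRows-[] []       = refl
dropRows-[] (_ ∷ fs) = refl

all-dropRows : ∀ {P : ℕ → Set} fs {O} → All P O → All P (dropRows fs O)
all-dropRows []           ps       = ps
all-dropRows (f ∷ fs)     []       = []
all-dropRows (true ∷ fs)  (p ∷ ps) = all-dropRows fs ps
all-dropRows (false ∷ fs) (p ∷ ps) = p ∷ all-dropRows fs ps

cross-dropRows : ∀ {D u A B} fs → Cross D u A B → Cross D u (dropRows fs A) (dropRows fs B)
cross-dropRows []           t            = t
cross-dropRows (f ∷ fs)     []           = []
cross-dropRows (true ∷ fs)  (cons q m t) =
  cross-weaken (<⇒≤ (≤-<-trans (move-≤ m) q)) (cross-dropRows fs t)
cross-dropRows (false ∷ fs) (cons q m t) = cons q m (cross-dropRows fs t)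

run-drop : ∀ {K O} fs → Run K O → Run (dropPaths K fs) (dropRows fs O)
run-drop fs []             = subst (Run []) (sym (dropRows-[] fs)) []
run-drop fs (stay o R)     = stay (all-dropRows fs o) (run-drop fs R)
run-drop [] (push o R)     = push o (run-drop [] R)
run-drop (true ∷ fs)  (push o R) = stay (all-dropRows fs o) (run-drop fs R)
run-drop (false ∷ fs) (push o R) = push (all-dropRows fs o) (run-drop fs R)
run-drop fs (pass t R)     = pass (cross-dropRows fs t) (run-drop fs R)
run-drop fs (exit d t R)   = exit d (cross-dropRows fs t) (run-drop (false ∷ fs) R)

-- Lower envelopes

-- The lower of the two paths in the first few places, the path of X afterwards.
data Mix : Stack → Stack → Stack → Set where
  done  : ∀ {X Y} → Mix X Y X
  left  : ∀ {x y X Y Z} → y ≤ x → Mix X Y Z → Mix (x ∷ X) (y ∷ Y) (x ∷ Z)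
  right : ∀ {x y X Y Z} → x ≤ y → Mix X Y Z → Mix (x ∷ X) (y ∷ Y) (y ∷ Z)

move-join : ∀ {D x x′ y y′} → y ≤ x → x′ < y′ → Move D x x′ → Move D y y′ → Move D x y′
move-join y≤x x′<y′ mx (straight _) =
  contradiction (<-≤-trans x′<y′ (≤-trans y≤x (move-≤ mx))) (<-irrefl refl)
move-join y≤x x′<y′ (straight n)   (turn _ d _)  = contradiction d (n y≤x)
move-join y≤x x′<y′ (turn p dx _) (turn _ _ d) = turn (≤-trans p (<⇒≤ x′<y′)) dx d

cross-mix : ∀ {D u v w X X′ Y Y′ Z} → u ≤ w → v ≤ w →
            Cross D u X X′ → Cross D v Y Y′ → Mix X Y Z →
            ∃[ Z′ ] Cross D w Z Z′ × Mix X′ Y′ Z′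
cross-mix p q s t done = _ , cross-weaken p s , done
cross-mix p q (cons {b = x′} x′<u mx s) (cons {b = y′} y′<v my t) (left y≤x M)
  with cross-mix ≤-refl y≤x s t M | <-cmp x′ y′
... | Z′ , c , M′ | tri = helper tri
  where
  helper : Tri (x′ < y′) (x′ ≡ y′) (y′ < x′) → _
  helper (tri< l _ _)    = _ , cons (<-≤-trans y′<v q) (move-join y≤x l mx my) c , right (<⇒≤ l) M′
  helper (tri≈ _ refl _) = _ , cons (<-≤-trans x′<u p) mx c , left ≤-refl M′
  helper (tri> _ _ l)    = _ , cons (<-≤-trans x′<u p) mx c , left (<⇒≤ l) M′
cross-mix p q (cons {b = x′} x′<u mx s) (cons {b = y′} y′<v my t) (right x≤y M)
  with cross-mix x≤y ≤-refl s t M | <-cmp x′ y′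
... | Z′ , c , M′ | tri = helper tri
  where
  helper : Tri (x′ < y′) (x′ ≡ y′) (y′ < x′) → _
  helper (tri< l _ _)    = _ , cons (<-≤-trans y′<v q) my c , right (<⇒≤ l) M′
  helper (tri≈ _ refl _) = _ , cons (<-≤-trans y′<v q) my c , right ≤-refl M′
  helper (tri> _ _ l)    = _ , cons (<-≤-trans x′<u p) (move-join x≤y l my mx) c , left (<⇒≤ l) M′

all-mix : ∀ {P : ℕ → Set} {X Y Z} → All P X → All P Y → Mix X Y Z → All P Z
all-mix ps       qs       done        = ps
all-mix (p ∷ ps) (q ∷ qs) (left _ M)  = p ∷ all-mix ps qs M
all-mix (p ∷ ps) (q ∷ qs) (right _ M) = q ∷ all-mix ps qs M

rest-mix : ∀ {C X Y Z} → Mix X Y Z → Rest C X → Rest C Y → Rest C Z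
rest-mix done S _ = S
rest-mix M (stay o S) (stay p S′) = stay (all-mix o p M) (rest-mix M S S′)
rest-mix M (push o S) (push p S′) = push (all-mix o p M) (rest-mix (left ≤-refl M) S S′)
rest-mix M (pass {u = u} s S) (pass {u = v} t S′) with ≤-total u v
... | inj₁ p = let _ , c , M′ = cross-mix p ≤-refl s t M in pass c (rest-mix M′ S S′)
... | inj₂ p = let _ , c , M′ = cross-mix ≤-refl p s t M in pass c (rest-mix M′ S S′)
rest-mix (left y≤x M) (exit d s S) (exit _ t S′) =
  let _ , c , M′ = cross-mix ≤-refl y≤x s t M in exit d c (rest-mix M′ S S′)
rest-mix (right x≤y M) (exit _ s S) (exit d t S′) =
  let _ , c , M′ = cross-mix x≤y ≤-refl s t M in exit d c (rest-mix M′ S S′)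

drop-column : ∀ C {D K} → Run (C ʳ++ ((col D , true) ∷ K)) [] →
              Run (C ʳ++ ((col D , false) ∷ dropPaths K (true ∷ []))) []
drop-column C R with split C R
... | _ , exit _ t R′ , S = join (pass t (run-drop (true ∷ []) R′)) S

-- Only the lowest path of the first family changes: it becomes its lower envelope
-- with the path of the second family that starts in row r.
reroute : ∀ C {r K K′} → Run (C ʳ++ ((row r , true) ∷ K)) [] →
          Run (C ʳ++ ((row r , false) ∷ K′)) [] →
          Run (C ʳ++ ((row r , false) ∷ dropPaths K (true ∷ []))) []
reroute C R R′ with split C R | split C R′
... | [] , stay _ _ , S | _ , push _ _ , S′ with () ← rest-length S S′
... | o ∷ O , stay (o<r ∷ O<r) R₁ , S | _ , push _ _ , S′ =
  join (push O<r (run-drop (true ∷ []) R₁)) (rest-mix (right (<⇒≤ o<r) done) S S′)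

-- Removing the paths flagged in fs and then, among the remaining ones, those
-- flagged in gs amounts to removing the paths flagged in hs.
data Merge : List Bool → List Bool → List Bool → Set where
  ignore  : ∀ {fs} → Merge [] fs fs
  below : ∀ {gs fs hs} → Merge gs fs hs → Merge gs (true ∷ fs) (true ∷ hs)
  take  : ∀ {g gs fs hs} → Merge gs fs hs → Merge (g ∷ gs) (false ∷ fs) (g ∷ hs)

dropPaths-merge : ∀ {gs fs hs} → Merge gs fs hs → ∀ K →
                  dropPaths (dropPaths K fs) gs ≡ dropPaths K hs
dropPaths-merge M [] = refl
dropPaths-merge M ((row r , true) ∷ K) = cong (_ ∷_) (dropPaths-merge M K)
dropPaths-merge (ignore {[]}) ((row r , false) ∷ K) = cong (_ ∷_) (dropPaths-merge ignore K)
dropPaths-merge (ignore {true ∷ fs}) ((row r , false) ∷ K) = cong (_ ∷_) (dropPaths-merge ignore K)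
dropPaths-merge (ignore {false ∷ fs}) ((row r , false) ∷ K) = cong (_ ∷_) (dropPaths-merge ignore K)
dropPaths-merge (below M) ((row r , false) ∷ K) = cong (_ ∷_) (dropPaths-merge M K)
dropPaths-merge (take M) ((row r , false) ∷ K) = cong (_ ∷_) (dropPaths-merge M K)
dropPaths-merge M ((col D , false) ∷ K) = cong (_ ∷_) (dropPaths-merge M K)
dropPaths-merge M ((col D , true) ∷ K) = cong (_ ∷_) (dropPaths-merge (take M) K)

dropPaths-none : ∀ t K → dropPaths K (replicate t false) ≡ K
dropPaths-none t       []                    = refl
dropPaths-none t       ((row r , true) ∷ K)  = cong (_ ∷_) (dropPaths-none t K)
dropPaths-none zero    ((row r , false) ∷ K) = cong (_ ∷_) (dropPaths-none zero K)
dropPaths-none (suc t) ((row r , false) ∷ K) = cong (_ ∷_) (dropPaths-none t K)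
dropPaths-none t       ((col D , false) ∷ K) = cong (_ ∷_) (dropPaths-none t K)
dropPaths-none t       ((col D , true) ∷ K)  = cong (_ ∷_) (dropPaths-none (suc t) K)

-- The entries of the second list bound from below those entries of the first
-- one whose flag is false.
data Embeds : List Bool → List ℕ → List ℕ → Set where
  []   : Embeds [] [] []
  keep : ∀ {fs x y σ τ} → y ≤ x → Embeds fs σ τ → Embeds (false ∷ fs) (x ∷ σ) (y ∷ τ)
  omit : ∀ {fs x σ τ} → Embeds fs σ τ → Embeds (true ∷ fs) (x ∷ σ) τ

lower : ∀ {fs σ τ x y} → y ≤ x → Embeds fs σ (x ∷ τ) → Embeds fs σ (y ∷ τ)
lower p (keep q E) = keep (≤-trans p q) E
lower p (omit E)   = omit (lower p E)

forget : ∀ {fs σ τ x} → Embeds fs σ (x ∷ τ) →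
         ∃[ gs ] Merge (true ∷ []) fs gs × Embeds gs σ τ
forget (keep _ E) = _ , take ignore , omit E
forget (omit E)   = let _ , M , E′ = forget E in _ , below M , omit E′

record IsLinked (𝓑 : Word → Set) : Set where
  field
    drop-col : ∀ C {D K} → 𝓑 (C ʳ++ ((col D , true) ∷ K)) →
               𝓑 (C ʳ++ ((col D , false) ∷ dropPaths K (true ∷ [])))
    drop-row : ∀ C {r K K′} → 𝓑 (C ʳ++ ((row r , true) ∷ K)) →
               𝓑 (C ʳ++ ((row r , false) ∷ K′)) →
               𝓑 (C ʳ++ ((row r , false) ∷ dropPaths K (true ∷ [])))
    balanced : ∀ {W} → 𝓑 W → Height W 0
    avoid?   : ∀ C {r b K} → 𝓑 (C ʳ++ ((row r , b) ∷ K)) →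
               Dec (∃[ K′ ] 𝓑 (C ʳ++ ((row r , false) ∷ K′)))

module Codes {𝓑 : Word → Set} (linked : IsLinked 𝓑) where

  open IsLinked linked

  Avoidable : Word → ℕ → Set
  Avoidable C r = ∃[ K ] 𝓑 (C ʳ++ ((row r , false) ∷ K))

  -- Code C e σ K holds if C ʳ++ K is a basis, e lists the exponents of the
  -- positions in K, and σ lists, for the columns of C that have not been matched
  -- with a row in C, how many passive rows in K are charged to them.
  data Code : ∀ {i} → Word → Vec ℕ i → List ℕ → Word → Set where
    []    : ∀ {C} → 𝓑 (C ʳ++ []) → Code C [] [] []
    skip  : ∀ {i C D σ K} {e : Vec ℕ i} → Code ((col D , false) ∷ C) e σ K →
            Code C (0 ∷ e) σ ((col D , false) ∷ K)
    open′ : ∀ {i C D σ K x} {e : Vec ℕ i} → Code ((col D , true) ∷ C) e (x ∷ σ) K →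
            Code C (suc x ∷ e) σ ((col D , true) ∷ K)
    keep  : ∀ {i C r σ K} {e : Vec ℕ i} → ¬ Avoidable C r →
            Code ((row r , true) ∷ C) e σ K → Code C (0 ∷ e) σ ((row r , true) ∷ K)
    raise : ∀ {i C r σ K x} {e : Vec ℕ i} → Avoidable C r →
            Code ((row r , true) ∷ C) e (x ∷ σ) K →
            Code C (0 ∷ e) (suc x ∷ σ) ((row r , true) ∷ K)
    close : ∀ {i C r σ K} {e : Vec ℕ i} → Code ((row r , false) ∷ C) e σ K →
            Code C (0 ∷ e) (0 ∷ σ) ((row r , false) ∷ K)

  code-basis : ∀ {i C σ K} {e : Vec ℕ i} → Code C e σ K → 𝓑 (C ʳ++ K)
  code-basis ([] b)      = b
  code-basis (skip c)    = code-basis c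
  code-basis (open′ c)   = code-basis c
  code-basis (keep _ c)  = code-basis c
  code-basis (raise _ c) = code-basis c
  code-basis (close c)   = code-basis c

  code-injective : ∀ {i C σ K K′} {e : Vec ℕ i} → map proj₁ K ≡ map proj₁ K′ →
                   Code C e σ K → Code C e σ K′ → K ≡ K′
  code-injective _  ([] _) ([] _) = refl
  code-injective eq (skip c) (skip c′) with refl , eq′ ← ∷-injective eq =
    cong (_ ∷_) (code-injective eq′ c c′)
  code-injective eq (open′ c) (open′ c′) with refl , eq′ ← ∷-injective eq =
    cong (_ ∷_) (code-injective eq′ c c′)
  code-injective eq (keep _ c) (keep _ c′) with refl , eq′ ← ∷-injective eq =
    cong (_ ∷_) (code-injective eq′ c c′)
  code-injective eq (keep n _) (raise a _) with refl , _ ← ∷-injective eq = contradiction a n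
  code-injective eq (keep n _) (close c) with refl , _ ← ∷-injective eq =
    contradiction (_ , code-basis c) n
  code-injective eq (raise a _) (keep n _) with refl , _ ← ∷-injective eq = contradiction a n
  code-injective eq (raise _ c) (raise _ c′) with refl , eq′ ← ∷-injective eq =
    cong (_ ∷_) (code-injective eq′ c c′)
  code-injective eq (close c) (keep n _) with refl , _ ← ∷-injective eq =
    contradiction (_ , code-basis c) n
  code-injective eq (close c) (close c′) with refl , eq′ ← ∷-injective eq =
    cong (_ ∷_) (code-injective eq′ c c′)

  code-functional : ∀ {i C σ σ′ K} {e e′ : Vec ℕ i} → Code C e σ K → Code C e′ σ′ K → e ≡ e′ × σ ≡ σ′
  code-functional ([] _) ([] _) = refl , refl
  code-functional (skip c) (skip c′) with code-functional c c′
  ... | refl , refl = refl , refl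
  code-functional (open′ c) (open′ c′) with code-functional c c′
  ... | refl , refl = refl , refl
  code-functional (keep _ c) (keep _ c′) with code-functional c c′
  ... | refl , refl = refl , refl
  code-functional (keep n _) (raise a _) = contradiction a n
  code-functional (raise a _) (keep n _) = contradiction a n
  code-functional (raise _ c) (raise _ c′) with code-functional c c′
  ... | refl , refl = refl , refl
  code-functional (close c) (close c′) with code-functional c c′
  ... | refl , refl = refl , refl

  Level : Word → ℕ → Set
  Level C h = ∀ {K} → 𝓑 (C ʳ++ K) → Height K h

  level-stay : ∀ C {r h} → Level C h → Level ((row r , true) ∷ C) h
  level-stay _ H b with stay h ← H b = h

  level-push : ∀ C {r h} → Level C (suc h) → Level ((row r , false) ∷ C) h
  level-push _ H b with push h ← H b = h

  level-pass : ∀ C {D h} → Level C h → Level ((col D , false) ∷ C) h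
  level-pass _ H b with pass h ← H b = h

  level-exit : ∀ C {D h} → Level C h → Level ((col D , true) ∷ C) (suc h)
  level-exit _ H b with exit h ← H b = h

  -- Decoding a monomial and one of its divisors in parallel.  The unmatched columns
  -- of the divisor are among those of the monomial, and removing the paths to the
  -- other ones turns every completion of C into a completion of C′.
  shrink : ∀ {i C C′ fs σ τ K} {e e′ : Vec ℕ i} → Code C e σ K → Pointwise _≤_ e′ e →
           Embeds fs σ τ → Level C′ (length τ) →
           (∀ {K} → 𝓑 (C ʳ++ K) → 𝓑 (C′ ʳ++ dropPaths K fs)) →
           ∃[ K′ ] Code C′ e′ τ K′
  advance : ∀ {i C C′ r b fs σ τ K} {e e′ : Vec ℕ i} → Code ((row r , b) ∷ C) e σ K →
            Pointwise _≤_ e′ e → Embeds fs σ τ → Level C′ (length τ) →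
            (∀ {K} → 𝓑 (C ʳ++ ((row r , b) ∷ K)) →
                     𝓑 (C′ ʳ++ ((row r , true) ∷ dropPaths K fs))) →
            ∃[ K′ ] Code C′ (0 ∷ e′) τ K′

  shrink ([] b) [] [] H J = [] , [] (J b)
  shrink {C′ = C′} (skip c) (z≤n ∷ p) E H J =
    let _ , c′ = shrink c p E (level-pass C′ H) J in _ , skip c′
  shrink {C′ = C′} {fs = fs} (open′ {D = D} c) (z≤n ∷ p) E H J =
    let _ , c′ = shrink c p (omit E) (level-pass C′ H)
                   (λ {K} b → subst (λ K → 𝓑 (C′ ʳ++ ((col D , false) ∷ K)))
                                    (dropPaths-merge {true ∷ []} (take ignore) K)
                                    (drop-col C′ (J b)))
    in _ , skip c′
  shrink {C′ = C′} (open′ c) (s≤s q ∷ p) E H J =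
    let _ , c′ = shrink c p (keep q E) (level-exit C′ H) J in _ , open′ c′
  shrink (keep _ c) (z≤n ∷ p) E H J = advance c p E H J
  shrink {C′ = C′} (raise (_ , b) c) (z≤n ∷ p) (keep {y = suc y} (s≤s q) E) H J =
    let _ , c′ = shrink c p (keep q E) (level-stay C′ H) J in _ , raise (_ , J b) c′
  shrink {C′ = C′} (raise {r = r} (_ , b) c) (z≤n ∷ p) (keep {y = zero} q E) H J =
    let _ , c′ = shrink c p (omit E) (level-push C′ H)
                   (λ {K} b′ → subst (λ K → 𝓑 (C′ ʳ++ ((row r , false) ∷ K)))
                                     (dropPaths-merge {true ∷ []} (take ignore) K)
                                     (drop-row C′ (J b′) (J b)))
    in _ , close c′
  shrink (raise _ c) (z≤n ∷ p) (omit E) H J = advance c p (omit E) H J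
  shrink {C′ = C′} (close c) (z≤n ∷ p) (keep z≤n E) H J =
    let _ , c′ = shrink c p E (level-push C′ H) J in _ , close c′
  shrink (close c) (z≤n ∷ p) (omit E) H J = advance c p E H J

  advance {C′ = C′} {r} c p E H J with avoid? C′ (J (code-basis c))
  advance {C′ = C′} c p E H J | no n = let _ , c′ = shrink c p E (level-stay C′ H) J in _ , keep n c′
  advance {τ = []} c p E H J | yes (_ , b) with () ← H b
  advance {C′ = C′} {τ = suc y ∷ τ} c p E H J | yes a =
    let _ , c′ = shrink c p (lower (n≤1+n y) E) (level-stay C′ H) J in _ , raise a c′
  advance {C′ = C′} {r} {τ = zero ∷ τ} c p E H J | yes (_ , b) =
    let _ , M , E′ = forget E
        _ , c′ = shrink c p E′ (level-push C′ H)
                   (λ {K} b′ → subst (λ K → 𝓑 (C′ ʳ++ ((row r , false) ∷ K)))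
                                     (dropPaths-merge M K)
                                     (drop-row C′ (J b′) b))
    in _ , close c′

  divisor-code : ∀ {i K} {e e′ : Vec ℕ i} → Code [] e [] K → Pointwise _≤_ e′ e →
                 ∃[ K′ ] Code [] e′ [] K′
  divisor-code c p = shrink c p [] balanced (λ {K} → subst 𝓑 (sym (dropPaths-none 0 K)))

infixl 6 _[_≔_]

choose : ∀ {A : Set} → Dec A → Bool → Bool → Bool
choose (yes _) b c = b
choose (no _)  b c = c

_[_≔_] : (ℕ → Bool) → ℕ → Bool → ℕ → Bool
(f [ x ≔ b ]) y = choose (y ≟ x) b (f y)

swap : (ℕ → Bool) → ℕ → ℕ → ℕ → Bool
swap f x y = f [ x ≔ false ] [ y ≔ true ]

update-same : ∀ f x b → (f [ x ≔ b ]) x ≡ b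
update-same f x b with x ≟ x
... | yes _ = refl
... | no ¬p = contradiction refl ¬p

update-other : ∀ f {x y} b → y ≢ x → (f [ x ≔ b ]) y ≡ f y
update-other f {x} {y} b y≢x with y ≟ x
... | yes p = contradiction p y≢x
... | no _  = refl

swap-in : ∀ f x y → swap f x y y ≡ true
swap-in f x y = update-same (f [ x ≔ false ]) y true

swap-out : ∀ f {x y} → x ≢ y → swap f x y x ≡ false
swap-out f {x} {y} x≢y = trans (update-other (f [ x ≔ false ]) true x≢y) (update-same f x false)

swap-other : ∀ f {x y z} → z ≢ x → z ≢ y → swap f x y z ≡ f z
swap-other f z≢x z≢y = trans (update-other (f [ _ ≔ false ]) true z≢y) (update-other f false z≢x)

swap-true : ∀ f x y z → swap f x y z ≡ true → z ≡ y ⊎ (z ≢ x × f z ≡ true)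
swap-true f x y z eq with z ≟ y
... | yes p = inj₁ p
... | no _ with z ≟ x
...   | no q = inj₂ (q , eq)

swap-false : ∀ f x y z → swap f x y z ≡ false → z ≡ x ⊎ (z ≢ y × f z ≡ false)
swap-false f x y z eq with z ≟ y
... | no q with z ≟ x
...   | yes p = inj₁ p
...   | no _  = inj₂ (q , eq)

swap-return : ∀ f {j} m p → f j ≡ false → ∀ x → swap (swap f m j) j p x ≡ swap f m p x
swap-return f {j} m p fj x with x ≟ m | x ≟ j | x ≟ p
... | _     | _     | yes _ = refl
... | yes _ | yes _ | no _  = refl
... | yes _ | no _  | no _  = refl
... | no _  | yes q | no _  = sym (trans (cong f q) fj)
... | no _  | no _  | no _  = refl

swap-chain : ∀ f {i z m} → f i ≡ true → i ≢ m → z ≢ m → ∀ x →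
             swap (swap f i z) m i x ≡ swap f m z x
swap-chain f {i} {z} {m} fi i≢m z≢m x with x ≟ m | x ≟ i | x ≟ z
... | yes p | yes q | _     = contradiction (trans (sym q) p) i≢m
... | yes p | no _  | yes q = contradiction (trans (sym q) p) z≢m
... | yes _ | no _  | no _  = refl
... | no _  | yes _ | yes _ = refl
... | no _  | yes q | no _  = sym (trans (cong f q) fi)
... | no _  | no _  | yes _ = refl
... | no _  | no _  | no _  = refl

swap-comm : ∀ f {i z m j} → i ≢ m → i ≢ j → z ≢ m → ∀ x →
            swap (swap f i z) m j x ≡ swap (swap f m j) i z x
swap-comm f {i} {z} {m} {j} i≢m i≢j z≢m x with x ≟ m | x ≟ j | x ≟ i | x ≟ z
... | _     | yes p | yes q | _     = contradiction (trans (sym q) p) i≢j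
... | _     | yes _ | no _  | yes _ = refl
... | _     | yes _ | no _  | no _  = refl
... | yes p | no _  | yes q | _     = contradiction (trans (sym q) p) i≢m
... | yes p | no _  | no _  | yes q = contradiction (trans (sym q) p) z≢m
... | yes _ | no _  | no _  | no _  = refl
... | no _  | no _  | yes _ | yes _ = refl
... | no _  | no _  | yes _ | no _  = refl
... | no _  | no _  | no _  | yes _ = refl
... | no _  | no _  | no _  | no _  = refl

true≢false : ∀ {b : Bool} → b ≡ true → b ≢ false
true≢false refl ()

-- Words

-- The depth at which an unmatched column lies in the stack after reading a letter,
-- or nothing if the letter matches it.
after : Letter → ℕ → Maybe ℕ
after (row _ , false) zero    = nothing
after (row _ , false) (suc t) = just t
after (row _ , true)  t       = just t
after (col _ , false) t       = just t
after (col _ , true)  t       = just (suc t)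

after-nothing : ∀ {s b t} → after (s , b) t ≡ nothing → b ≡ false
after-nothing {row _} {false} _ = refl
after-nothing {row _} {true} ()
after-nothing {col _} {false} ()
after-nothing {col _} {true} ()

selector : ℕ → List Bool
selector zero    = true ∷ []
selector (suc t) = false ∷ selector t

drop-letter : ∀ l t K →
  (∃[ t′ ] after l t ≡ just t′ ×
           dropPaths (l ∷ K) (selector t) ≡ l ∷ dropPaths K (selector t′)) ⊎
  (after l t ≡ nothing × dropPaths (l ∷ K) (selector t) ≡ (proj₁ l , true) ∷ K)
drop-letter (row r , false) zero    K = inj₂ (refl , cong (_ ∷_) (dropPaths-none 0 K))
drop-letter (row r , false) (suc t) K = inj₁ (t , refl , refl)
drop-letter (row r , true)  t       K = inj₁ (t , refl , refl)
drop-letter (col D , false) t       K = inj₁ (t , refl , refl)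
drop-letter (col D , true)  t       K = inj₁ (suc t , refl , refl)

-- The second list has one entry more than the first if the index is just t, namely
-- at place t; apart from it, it dominates the first list.
data Shift : Maybe ℕ → List ℕ → List ℕ → Set where
  []     : Shift nothing [] []
  cons   : ∀ {x y σ τ} → x ≤ y → Shift nothing σ τ → Shift nothing (x ∷ σ) (y ∷ τ)
  insert : ∀ {y σ τ} → Shift nothing σ τ → Shift (just 0) σ (y ∷ τ)
  there  : ∀ {t x y σ τ} → x ≤ y → Shift (just t) σ τ → Shift (just (suc t)) (x ∷ σ) (y ∷ τ)

shift-suc : ∀ {t σ τ y} → Shift t σ (y ∷ τ) → Shift t σ (suc y ∷ τ)
shift-suc (cons p s)  = cons (≤-trans p (n≤1+n _)) s
shift-suc (insert s)  = insert s
shift-suc (there p s) = there (≤-trans p (n≤1+n _)) s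

module Words (S : ℕ → Step) where

  word : (ℕ → Bool) → ℕ → Word
  word f zero    = []
  word f (suc i) = (S i , f i) ∷ word f i

  word-cong : ∀ {f g} i → (∀ {x} → x < i → f x ≡ g x) → word f i ≡ word g i
  word-cong zero    eq = refl
  word-cong (suc i) eq = cong₂ (λ b K → (S i , b) ∷ K) (eq ≤-refl) (word-cong i (eq ∘ m<n⇒m<1+n))

  word-length : ∀ f i → length (word f i) ≡ i
  word-length f zero    = refl
  word-length f (suc i) = cong suc (word-length f i)

  word-injective : ∀ {f g} i → word f i ≡ word g i → ∀ {x} → x < i → f x ≡ g x
  word-injective {f} {g} (suc i) eq {x} (s≤s x≤i) with m≤n⇒m<n∨m≡n x≤i
  ... | inj₁ x<i  = word-injective i (cong tail eq) x<i
    where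
    tail : Word → Word
    tail []      = []
    tail (_ ∷ K) = K
  ... | inj₂ refl = cong headBit eq
    where
    headBit : Word → Bool
    headBit []            = false
    headBit ((_ , b) ∷ _) = b

  word-labels : ∀ f g i → map proj₁ (word f i) ≡ map proj₁ (word g i)
  word-labels f g zero    = refl
  word-labels f g (suc i) = cong (S i ∷_) (word-labels f g i)

  -- The row p that matches the unmatched column lying at depth t when the positions
  -- from i upwards have been read.
  data Partner (f : ℕ → Bool) : ℕ → ℕ → ℕ → Set where
    here  : ∀ {t i} → after (S i , f i) t ≡ nothing → Partner f t (suc i) i
    there : ∀ {t t′ i p} → after (S i , f i) t ≡ just t′ → Partner f t′ i p → Partner f t (suc i) p

  partner-< : ∀ {f t i p} → Partner f t i p → p < i
  partner-< (here _)    = ≤-refl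
  partner-< (there _ P) = m<n⇒m<1+n (partner-< P)

  partner-out : ∀ {f t i p} → Partner f t i p → f p ≡ false
  partner-out (here eq)   = after-nothing eq
  partner-out (there _ P) = partner-out P

  partner-unique : ∀ {f t i p q} → Partner f t i p → Partner f t i q → p ≡ q
  partner-unique (here _)     (here _)     = refl
  partner-unique (here eq)    (there eq′ _) with () ← trans (sym eq) eq′
  partner-unique (there eq _) (here eq′)    with () ← trans (sym eq) eq′
  partner-unique (there eq P) (there eq′ Q) with refl ← just-injective (trans (sym eq) eq′) =
    partner-unique P Q

  find-partner : ∀ f t i →
    (∃[ p ] Partner f t i p × dropPaths (word f i) (selector t) ≡ word (f [ p ≔ true ]) i) ⊎
    dropPaths (word f i) (selector t) ≡ word f i
  find-partner f t zero = inj₂ refl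
  find-partner f t (suc i) with drop-letter (S i , f i) t (word f i)
  ... | inj₂ (eq , q) = inj₁ (i , here eq , trans q
    (cong₂ (λ b K → (S i , b) ∷ K) (sym (update-same f i true))
           (word-cong i (λ x<i → sym (update-other f true (<⇒≢ x<i))))))
  ... | inj₁ (t′ , eq , q) with find-partner f t′ i
  ...   | inj₂ q′ = inj₂ (trans q (cong (_ ∷_) q′))
  ...   | inj₁ (p , P , q′) = inj₁ (p , there eq P , trans q
    (cong₂ (λ b K → (S i , b) ∷ K)
           (sym (update-other f true (<⇒≢ (partner-< P) ∘ sym))) q′))

module Purity {𝓑 : Word → Set} (linked : IsLinked 𝓑) (S : ℕ → Step) (n : ℕ) where

  open IsLinked linked
  open Codes linked
  open Words S

  Basisᶠ : (ℕ → Bool) → Set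
  Basisᶠ f = 𝓑 (word f n)

  Exchange : Set
  Exchange = ∀ {a b x} → Basisᶠ a → Basisᶠ b → x < n → a x ≡ true → b x ≡ false →
             ∃[ y ] y < n × b y ≡ true × a y ≡ false × Basisᶠ (swap a x y)

  record Above (f : ℕ → Bool) (C : Word) (i : ℕ) : Set where
    constructor above
    field prepend : ∀ g → (∀ {x} → i ≤ x → g x ≡ f x) → C ʳ++ word g i ≡ word g n
  open Above

  above-top : ∀ {f} → Above f [] n
  above-top = above (λ g _ → refl)

  above-step : ∀ {f C i b} → Above f C (suc i) → b ≡ f i → Above f ((S i , b) ∷ C) i
  above-step {f} {C} {i} {b} A refl = above (λ g eq → trans
    (cong (λ b → C ʳ++ ((S i , b) ∷ word g i)) (sym (eq ≤-refl)))
    (prepend A g (λ p → eq (<⇒≤ p))))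

  above-cong : ∀ {f g C i} → (∀ {x} → i ≤ x → g x ≡ f x) → Above f C i → Above g C i
  above-cong eq A = above (λ h eq′ → prepend A h (λ p → trans (eq′ p) (eq p)))

  basisᶠ-cong : ∀ {f g} → (∀ {x} → x < n → f x ≡ g x) → Basisᶠ f → Basisᶠ g
  basisᶠ-cong eq = subst 𝓑 (word-cong n eq)

  data Free (C : Word) : Step → Set where
    col : ∀ {D} → Free C (col D)
    row : ∀ {r} → Avoidable C r → Free C (row r)

  drop-free : ∀ {C s K} → Free C s → 𝓑 (C ʳ++ ((s , true) ∷ K)) →
              𝓑 (C ʳ++ ((s , false) ∷ dropPaths K (true ∷ [])))
  drop-free {C} col           b = drop-col C b
  drop-free {C} (row (_ , a)) b = drop-row C b a

  Passiveᶠ : (ℕ → Bool) → ℕ → Set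
  Passiveᶠ f i = ∃[ z ] z < i × f z ≡ false × Basisᶠ (swap f i z)

  avoid-by : ∀ {f g C i r} → Above f C (suc i) → Basisᶠ g → (∀ {x} → i < x → g x ≡ f x) →
             g i ≡ false → S i ≡ row r → Avoidable C r
  avoid-by {g = g} {C} {i} A b eq gi si = word g i ,
    subst 𝓑 (trans (sym (prepend A g eq)) (cong₂ (λ s b → C ʳ++ ((s , b) ∷ word g i)) si gi)) b

  free-by : ∀ {f g C i} → Above f C (suc i) → Basisᶠ g → (∀ {x} → i < x → g x ≡ f x) →
            g i ≡ false → Free C (S i)
  free-by {i = i} A b eq gi with S i in si
  ... | row r = row (avoid-by A b eq gi si)
  ... | col D = col

  prefix : ∀ {f i} → i < n → ∃[ C ] Above f C (suc i)
  prefix {f} = go n ≤-refl (_ , above-top)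
    where
    go : ∀ k {i} → k ≤ n → ∃[ C ] Above f C k → i < k → ∃[ C ] Above f C (suc i)
    go (suc k) k<n (C , A) i<1+k with m≤n⇒m<n∨m≡n (s≤s⁻¹ i<1+k)
    ... | inj₁ i<k  = go k (<⇒≤ k<n) (_ , above-step A refl) i<k
    ... | inj₂ refl = C , A

  passive-avoidable : ∀ {f C i r} → Above f C (suc i) → S i ≡ row r → Passiveᶠ f i → Avoidable C r
  passive-avoidable {f} A si (z , z<i , fz , b) = avoid-by A b
    (λ i<x → swap-other f (<⇒≢ i<x ∘ sym) (<⇒≢ (<-trans z<i i<x) ∘ sym))
    (swap-out f (<⇒≢ z<i ∘ sym)) si

  module _ (exchange : Exchange) where

    partner-swap : ∀ {f C i} → Above f C (suc i) → i < n → Basisᶠ f → f i ≡ true → Free C (S i) →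
                   ∃[ p ] Partner f 0 i p × Basisᶠ (swap f i p)
    partner-swap {f} {C} {i} A i<n b fi free with find-partner f 0 i
    ... | inj₁ (p , P , q) = p , P , subst 𝓑
      (trans (cong₂ (λ b K → C ʳ++ ((S i , b) ∷ K)) (sym (swap-out f (<⇒≢ (partner-< P) ∘ sym)))
                    (trans q (word-cong i agree)))
             (prepend A (swap f i p) (λ i<x →
               swap-other f (<⇒≢ i<x ∘ sym) (<⇒≢ (<-trans (partner-< P) i<x) ∘ sym))))
      (drop-free free (subst 𝓑 (trans (sym (prepend A f (λ _ → refl)))
                                      (cong (λ b → C ʳ++ ((S i , b) ∷ word f i)) fi)) b))
      where
      agree : ∀ {x} → x < i → (f [ p ≔ true ]) x ≡ swap f i p x
      agree {x} x<i with x ≟ p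
      ... | yes _ = refl
      ... | no _ = sym (update-other f false (<⇒≢ x<i))
    ... | inj₂ q with exchange b b⁻ i<n fi (update-same f i false)
      where
      b⁻ : Basisᶠ (f [ i ≔ false ])
      b⁻ = subst 𝓑
        (trans (cong₂ (λ b K → C ʳ++ ((S i , b) ∷ K)) (sym (update-same f i false))
                      (trans q (word-cong i (λ x<i → sym (update-other f false (<⇒≢ x<i))))))
               (prepend A (f [ i ≔ false ]) (λ i<x → update-other f false (<⇒≢ i<x ∘ sym))))
        (drop-free free (subst 𝓑 (trans (sym (prepend A f (λ _ → refl)))
                                        (cong (λ b → C ʳ++ ((S i , b) ∷ word f i)) fi)) b))
    ...   | y , _ , p , p′ , _ with y ≟ i
    ...     | no _ = contradiction p′ (true≢false p)

    free-passive : ∀ {f C i} → Above f C (suc i) → i < n → Basisᶠ f → f i ≡ true → Free C (S i) →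
                   Passiveᶠ f i
    free-passive A i<n b fi free =
      let p , P , b′ = partner-swap A i<n b fi free in p , partner-< P , partner-out P , b′

    data Next (l : Letter) : Maybe ℕ → Maybe ℕ → Set where
      unmarked : Next l nothing nothing
      marked : ∀ {t t′} → after l t ≡ just t′ → Next l (just t) (just t′)

    Dominated : ∀ {i} → Maybe ℕ → Vec ℕ i → Vec ℕ i → List ℕ → List ℕ → Set
    Dominated t e e′ σ σ′ = Pointwise _≤_ e e′ × Shift t σ σ′

    compare : ∀ {i C C′ s b K K′ t t′ σ σ′} {e e′ : Vec ℕ (suc i)} → Next (s , b) t t′ →
      (∀ {r} → s ≡ row r → b ≡ true → Avoidable C r → Avoidable C′ r) →
      (∀ {r} → s ≡ row r → b ≡ true → t ≡ just 0 → ¬ Avoidable C r) →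
      (∀ {e e′ : Vec ℕ i} {σ σ′} → Code ((s , b) ∷ C) e σ K → Code ((s , b) ∷ C′) e′ σ′ K′ →
         Dominated t′ e e′ σ σ′) →
      Code C e σ ((s , b) ∷ K) → Code C′ e′ σ′ ((s , b) ∷ K′) → Dominated t e e′ σ σ′
    compare unmarked        ap na rec (skip c) (skip c′) = let p , s = rec c c′ in z≤n ∷ p , s
    compare (marked refl) ap na rec (skip c) (skip c′) = let p , s = rec c c′ in z≤n ∷ p , s
    compare unmarked ap na rec (open′ c) (open′ c′) with rec c c′
    ... | p , cons q s = s≤s q ∷ p , s
    compare (marked refl) ap na rec (open′ c) (open′ c′) with rec c c′
    ... | p , there q s = s≤s q ∷ p , s
    compare unmarked        ap na rec (keep _ c) (keep _ c′) = let p , s = rec c c′ in z≤n ∷ p , s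
    compare (marked refl) ap na rec (keep _ c) (keep _ c′) = let p , s = rec c c′ in z≤n ∷ p , s
    compare unmarked        ap na rec (keep _ c) (raise _ c′) =
      let p , s = rec c c′ in z≤n ∷ p , shift-suc s
    compare (marked refl) ap na rec (keep _ c) (raise _ c′) =
      let p , s = rec c c′ in z≤n ∷ p , shift-suc s
    compare _ ap na rec (raise a _) (keep n _) = contradiction (ap refl refl a) n
    compare unmarked ap na rec (raise _ c) (raise _ c′) with rec c c′
    ... | p , cons q s = z≤n ∷ p , cons (s≤s q) s
    compare (marked refl) ap na rec (raise a c) (raise _ c′) with rec c c′
    ... | p , there q s = z≤n ∷ p , there (s≤s q) s
    ... | p , insert s  = contradiction a (na refl refl refl)
    compare unmarked ap na rec (close c) (close c′) =
      let p , s = rec c c′ in z≤n ∷ p , cons z≤n s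
    compare (marked {suc t} refl) ap na rec (close c) (close c′) =
      let p , s = rec c c′ in z≤n ∷ p , there z≤n s

    compare-removed : ∀ {i C C′ s K K′ t σ σ′} {e e′ : Vec ℕ (suc i)} →
      after (s , false) t ≡ nothing → (∀ {r} → s ≡ row r → ¬ Avoidable C r) →
      (∀ {e e′ : Vec ℕ i} {σ σ′} → Code ((s , true) ∷ C) e σ K →
         Code ((s , false) ∷ C′) e′ σ′ K′ → Dominated nothing e e′ σ σ′) →
      Code C e σ ((s , true) ∷ K) → Code C′ e′ σ′ ((s , false) ∷ K′) →
      Dominated (just t) e e′ σ σ′
    compare-removed {t = zero} eq na rec (keep _ c) (close c′) =
      let p , s = rec c c′ in z≤n ∷ p , insert s
    compare-removed eq na rec (raise a _) _ = contradiction a (na refl)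

    compare-added : ∀ {i C C′ s K K′ σ σ′} {e e′ : Vec ℕ (suc i)} →
      (∀ {r} → s ≡ row r → Avoidable C′ r) →
      (∀ {e e′ : Vec ℕ i} {σ σ′} → Code ((s , false) ∷ C) e σ K →
         Code ((s , true) ∷ C′) e′ σ′ K′ → Dominated (just 0) e e′ σ σ′) →
      Code C e σ ((s , false) ∷ K) → Code C′ e′ σ′ ((s , true) ∷ K′) →
      Dominated nothing e e′ σ σ′
    compare-added a rec (skip c) (open′ c′) with rec c c′
    ... | p , insert s = z≤n ∷ p , s
    compare-added a rec (close c) (keep n _) = contradiction (a refl) n
    compare-added a rec (close c) (raise _ c′) with rec c c′
    ... | p , insert s = z≤n ∷ p , cons z≤n s

    -- Since j is least, the column charged with (or opened by) j in f′ is matched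
    -- with m, so the stacks of f and f′ only differ between m and j, where that of
    -- f′ has one more column.
    module Swapped {f m j μ} (basis : Basisᶠ f) (m<j : m < j) (j<n : j < n)
      (m∈f : f m ≡ true) (j∉f : f j ≡ false) (row-m : S m ≡ row μ)
      (basis′ : Basisᶠ (swap f m j))
      (least : ∀ {z} → z < j → f z ≡ false → ¬ Basisᶠ (swap f m z)) where

      m<n : m < n
      m<n = <-trans m<j j<n

      f′ : ℕ → Bool
      f′ = swap f m j

      j∈f′ : f′ j ≡ true
      j∈f′ = swap-in f m j

      m∉f′ : f′ m ≡ false
      m∉f′ = swap-out f (<⇒≢ m<j)

      f′-other : ∀ {x} → x ≢ m → x ≢ j → f′ x ≡ f x
      f′-other = swap-other f

      passive-swap : ∀ {i} → i ≢ m → i ≢ j → i < n → f i ≡ true → Passiveᶠ f i → Passiveᶠ f′ i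
      passive-swap {i} i≢m i≢j i<n fi (z , z<i , fz , b)
        with exchange basis′ b i<n (trans (f′-other i≢m i≢j) fi)
                      (swap-out f (<⇒≢ z<i ∘ sym))
      ... | y , y<n , y∈ , y∉ , b′ with swap-true f i z y y∈
      ...   | inj₁ refl = z , z<i , y∉ , b′
      ...   | inj₂ (y≢i , fy) with swap-false f m j y y∉
      ...     | inj₂ (_ , fy′) = contradiction fy′ (true≢false fy)
      ...     | inj₁ refl with <-cmp m i
      ...       | tri< m<i _ _ = m , m<i , y∉ , b′
      ...       | tri≈ _ m≡i _ = contradiction m≡i y≢i
      ...       | tri> _ _ i<m
        with exchange b basis′ m<n (trans (swap-other f (i≢m ∘ sym) (<⇒≢ (<-trans z<i i<m) ∘ sym)) m∈f) m∉f′
      ...         | y , _ , y∈′ , y∉′ , b″ with swap-true f m j y y∈′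
      ...           | inj₁ refl = z , z<i , trans (f′-other (<⇒≢ (<-trans z<i i<m)) z≢j) fz ,
        basisᶠ-cong (λ {x} _ → swap-comm f i≢m i≢j (<⇒≢ (<-trans z<i i<m)) x) b″
        where
        z≢j : z ≢ j
        z≢j = <⇒≢ (<-trans z<i (<-trans i<m m<j))
      ...           | inj₂ (y≢m , fy′) with swap-false f i z y y∉′
      ...             | inj₂ (_ , fy″) = contradiction fy″ (true≢false fy′)
      ...             | inj₁ refl = contradiction 
        (basisᶠ-cong (λ {x} _ → swap-chain f fi i≢m (<⇒≢ (<-trans z<i i<m)) x) b″)
        (least (<-trans z<i (<-trans i<m m<j)) fz)

      persist : ∀ {i C C′ r} → i ≢ m → i ≢ j → i < n → Above f C (suc i) → Above f′ C′ (suc i) →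
                S i ≡ row r → f i ≡ true → Avoidable C r → Avoidable C′ r
      persist {C = C} i≢m i≢j i<n A A′ si fi a = passive-avoidable A′ si
        (passive-swap i≢m i≢j i<n fi
          (free-passive A i<n basis fi (subst (Free C) (sym si) (row a))))

      partner-m : ∀ {C} → Above f′ C (suc j) → Partner f′ 0 j m
      partner-m A with partner-swap A j<n basis′ j∈f′
        (free-by A basis (λ j<x → sym (f′-other (<⇒≢ (<-trans m<j j<x) ∘ sym) (<⇒≢ j<x ∘ sym))) j∉f)
      ... | p , P , b with p ≟ m
      ...   | yes refl = P
      ...   | no p≢m   = contradiction (basisᶠ-cong (λ {x} _ → swap-return f m p j∉f x) b)
        (least (partner-< P)
               (trans (sym (f′-other p≢m (<⇒≢ (partner-< P)))) (partner-out P)))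

      same-letter : ∀ {i t t′} → i ≢ m → i ≢ j → after (S i , f′ i) t ≡ t′ →
                    after (S i , f i) t ≡ t′
      same-letter {i} {t} i≢m i≢j eq =
        trans (cong (λ b → after (S i , b) t) (sym (f′-other i≢m i≢j))) eq

      partner-below : ∀ {i t p} → i ≤ j → Partner f′ t i m → Partner f t i p → p < m
      partner-below i≤j (here eq) (here eq′) = contradiction (after-nothing eq′) (true≢false m∈f)
      partner-below i≤j (here eq) (there _ Q) = partner-< Q
      partner-below i≤j (there eq P) (here eq′)
        with () ← trans (sym eq′) (same-letter (<⇒≢ (partner-< P) ∘ sym) (<⇒≢ i≤j) eq)
      partner-below i≤j (there eq P) (there eq′ Q)
        with refl ← just-injective (trans (sym eq′) (same-letter (<⇒≢ (partner-< P) ∘ sym) (<⇒≢ i≤j) eq)) =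
        partner-below (<⇒≤ i≤j) P Q

      Resumes : ℕ → ℕ → Set
      Resumes t i = ∀ g p → (∀ {x} → i ≤ x → x < j → g x ≡ f′ x) →
                    Partner g t i p → Partner g 0 j p

      -- Otherwise, exchanging i for its partner and m for j gives a basis in which
      -- i is the partner of j, and exchanging these two contradicts the choice of j.
      blocked : ∀ {i C C′ r} → Above f′ C′ (suc j) → i < j → m < i → Partner f′ 0 i m →
                Resumes 0 (suc i) → Above f C (suc i) → S i ≡ row r → f i ≡ true → ¬ Avoidable C r
      blocked {i} {C} {C′} Aⱼ i<j m<i P Q A si fi a
        with partner-swap A (<-trans i<j j<n) basis fi (subst (Free C) (sym si) (row a))
      ... | r , R , b
        with exchange b basis′ m<n
          (trans (swap-other f (<⇒≢ m<i) (<⇒≢ (partner-below (<⇒≤ i<j) P R) ∘ sym)) m∈f) m∉f′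
      ... | y , _ , y∈ , y∉ , b′ = conclude (swap-true f m j y y∈)
        where
        r<m : r < m
        r<m = partner-below (<⇒≤ i<j) P R
        r<j : r < j
        r<j = <-trans r<m m<j
        f₁ f₂ : ℕ → Bool
        f₁ = swap f i r
        f₂ = swap f₁ m j
        j∉f₁ : f₁ j ≡ false
        j∉f₁ = trans (swap-other f (<⇒≢ i<j ∘ sym) (<⇒≢ r<j ∘ sym)) j∉f
        chain : ∀ x → swap f₁ m i x ≡ swap f m r x
        chain = swap-chain f fi (<⇒≢ m<i ∘ sym) (<⇒≢ r<m)
        f₂-above : ∀ {x} → i < x → f₂ x ≡ f′ x
        f₂-above {x} i<x = trans (swap-comm f (<⇒≢ m<i ∘ sym) (<⇒≢ i<j) (<⇒≢ r<m) x)
          (swap-other f′ (<⇒≢ i<x ∘ sym) (<⇒≢ (<-trans (partner-< R) i<x) ∘ sym))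
        i∉f₂ : f₂ i ≡ false
        i∉f₂ = trans (swap-other f₁ (<⇒≢ m<i ∘ sym) (<⇒≢ i<j)) (swap-out f (<⇒≢ (partner-< R) ∘ sym))
        impossible : Basisᶠ f₂ → ¬ Basisᶠ f
        impossible b₂ _ with partner-swap (above-cong (λ j<x → f₂-above (<-trans i<j j<x)) Aⱼ) j<n b₂
          (swap-in f₁ m j)
          (free-by (above-cong (λ j<x → f₂-above (<-trans i<j j<x)) Aⱼ) b
            (λ j<x → sym (swap-other f₁ (<⇒≢ (<-trans m<j j<x) ∘ sym) (<⇒≢ j<x ∘ sym))) j∉f₁)
        ... | p , P′ , b″ with partner-unique P′
          (Q f₂ i (λ i<x _ → f₂-above i<x) (here (trans (cong₂ (λ s b → after (s , b) 0) si i∉f₂) refl)))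
        ... | refl = least r<j (partner-out R)
          (basisᶠ-cong (λ {x} _ → trans (swap-return f₁ m i j∉f₁ x) (chain x)) b″)
        conclude : y ≡ j ⊎ (y ≢ m × f y ≡ true) → _
        conclude (inj₁ refl) = impossible b′ basis
        conclude (inj₂ (_ , fy)) with swap-false f i r y y∉
        ... | inj₂ (_ , fy′) = true≢false fy fy′
        ... | inj₁ refl = least r<j (partner-out R) (basisᶠ-cong (λ {x} _ → chain x) b′)

      phase₁ : ∀ i {C C′ σ σ′} {e e′ : Vec ℕ i} → i ≤ m → Above f C i → Above f′ C′ i →
               Code C e σ (word f i) → Code C′ e′ σ′ (word f′ i) → Dominated nothing e e′ σ σ′
      phase₁ zero _ A A′ ([] _) ([] _) = [] , []
      phase₁ (suc i) {C} {C′} {σ} {σ′} {e} {e′} i<m A A′ c c′ =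
        compare unmarked
          (λ si fi → persist (<⇒≢ i<m) (<⇒≢ (<-trans i<m m<j)) (<-trans i<m m<n) A A′ si fi)
          (λ _ _ ())
          (phase₁ i (<⇒≤ i<m) (above-step A refl) (above-step A′ (sym eq)))
          c (subst (λ b → Code C′ e′ σ′ ((S i , b) ∷ word f′ i)) eq c′)
        where
        eq : f′ i ≡ f i
        eq = f′-other (<⇒≢ i<m) (<⇒≢ (<-trans i<m m<j))

      phase₂ : ∀ i t {C C′ C″ σ σ′} {e e′ : Vec ℕ i} → i ≤ j → Above f′ C″ (suc j) →
               Partner f′ t i m → Resumes t i → Above f C i → Above f′ C′ i →
               Code C e σ (word f i) → Code C′ e′ σ′ (word f′ i) → Dominated (just t) e e′ σ σ′
      phase₂ (suc i) t {C} {C′} {σ = σ} {σ′} {e} {e′} i<j Aⱼ (here eq) Q A A′ c c′ =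
        compare-removed (trans (cong (λ b → after (S m , b) t) (sym m∉f′)) eq)
          (λ sm a → let z , z<m , fz , b = free-passive A m<n basis m∈f (subst (Free C) (sym sm) (row a))
                    in least (<-trans z<m m<j) fz b)
          (phase₁ m ≤-refl (above-step A (sym m∈f)) (above-step A′ (sym m∉f′)))
          (subst (λ b → Code C e σ ((S m , b) ∷ word f m)) m∈f c)
          (subst (λ b → Code C′ e′ σ′ ((S m , b) ∷ word f′ m)) m∉f′ c′)
      phase₂ (suc i) t {C} {C′} {σ = σ} {σ′} {e} {e′} i<j Aⱼ (there {t′ = t′} eq P) Q A A′ c c′ =
        compare (marked (same-letter i≢m i≢j eq))
          (λ si fi → persist i≢m i≢j (<-trans i<j j<n) A A′ si fi)
          (λ { si fi refl → blocked Aⱼ i<j (partner-< P)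
                 (subst (λ t → Partner f′ t i m)
                   (just-injective (trans (sym eq) (cong₂ (λ s b → after (s , b) 0) si (trans f′i fi)))) P)
                 Q A si fi })
          (phase₂ i t′ (<⇒≤ i<j) Aⱼ P
            (λ g p agree R → Q g p (λ i<x → agree (<⇒≤ i<x))
               (there (trans (cong (λ b → after (S i , b) t) (agree ≤-refl i<j)) eq) R))
            (above-step A refl) (above-step A′ (sym f′i)))
          c (subst (λ b → Code C′ e′ σ′ ((S i , b) ∷ word f′ i)) f′i c′)
        where
        i≢m : i ≢ m
        i≢m = <⇒≢ (partner-< P) ∘ sym
        i≢j : i ≢ j
        i≢j = <⇒≢ i<j
        f′i : f′ i ≡ f i
        f′i = f′-other i≢m i≢j

      phase₃ : ∀ i {C C′ σ σ′} {e e′ : Vec ℕ i} → j < i → i ≤ n → Above f C i → Above f′ C′ i →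
               Code C e σ (word f i) → Code C′ e′ σ′ (word f′ i) → Dominated nothing e e′ σ σ′
      phase₃ (suc i) {C} {C′} {σ} {σ′} {e} {e′} j<1+i i<n A A′ c c′ = by-cases (i ≟ j)
        where
        at-j : i ≡ j → Dominated nothing e e′ σ σ′
        at-j refl = compare-added
          (λ sj → avoid-by A′ basis
            (λ j<x → sym (f′-other (<⇒≢ (<-trans m<j j<x) ∘ sym) (<⇒≢ j<x ∘ sym))) j∉f sj)
          (phase₂ j 0 ≤-refl A′ (partner-m A′) (λ _ _ _ P → P)
            (above-step A (sym j∉f)) (above-step A′ (sym j∈f′)))
          (subst (λ b → Code C e σ ((S j , b) ∷ word f j)) j∉f c)
          (subst (λ b → Code C′ e′ σ′ ((S j , b) ∷ word f′ j)) j∈f′ c′)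
        above-j : i ≢ j → Dominated nothing e e′ σ σ′
        above-j i≢j = compare unmarked
          (λ si fi → persist i≢m i≢j i<n A A′ si fi)
          (λ _ _ ())
          (phase₃ i j<i (<⇒≤ i<n) (above-step A refl) (above-step A′ (sym eq)))
          c (subst (λ b → Code C′ e′ σ′ ((S i , b) ∷ word f′ i)) eq c′)
          where
          j<i : j < i
          j<i = ≤∧≢⇒< (s≤s⁻¹ j<1+i) (i≢j ∘ sym)
          i≢m : i ≢ m
          i≢m = <⇒≢ (<-trans m<j j<i) ∘ sym
          eq : f′ i ≡ f i
          eq = f′-other i≢m i≢j
        by-cases : Dec (i ≡ j) → Dominated nothing e e′ σ σ′
        by-cases (yes i≡j) = at-j i≡j
        by-cases (no i≢j)  = above-j i≢j

      dominated : ∀ {σ σ′} {e e′ : Vec ℕ n} → Code [] e σ (word f n) → Code [] e′ σ′ (word f′ n) →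
                  Pointwise _≤_ e e′
      dominated c c′ = proj₁ (phase₃ n j<n ≤-refl above-top above-top c c′)

first : ∀ {P : ℕ → Set} → (∀ x → Dec (P x)) → ∀ k →
        (∃[ j ] j < k × P j × (∀ {z} → z < j → ¬ P z)) ⊎ (∀ {z} → z < k → ¬ P z)
first P? zero = inj₂ (λ ())
first P? (suc k) with first P? k
... | inj₁ (j , j<k , p , least) = inj₁ (j , m<n⇒m<1+n j<k , p , least)
... | inj₂ nowhere with P? k
...   | yes p = inj₁ (k , ≤-refl , p , nowhere)
...   | no ¬p = inj₂ (λ z<1+k → helper (m≤n⇒m<n∨m≡n (s≤s⁻¹ z<1+k)))
  where
  helper : ∀ {z} → z < k ⊎ z ≡ k → ¬ _
  helper (inj₁ z<k)  = nowhere z<k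
  helper (inj₂ refl) = ¬p

bit : Bool → ℕ
bit true  = 1
bit false = 0

count : (ℕ → Bool) → ℕ → ℕ
count p zero    = 0
count p (suc i) = bit (p i) + count p i

count-cong : ∀ {p q} i → (∀ {x} → x < i → p x ≡ q x) → count p i ≡ count q i
count-cong zero    eq = refl
count-cong (suc i) eq = cong₂ (λ b k → bit b + k) (eq ≤-refl) (count-cong i (eq ∘ m<n⇒m<1+n))

count-split : ∀ {p q r} i → (∀ {x} → x < i → bit (p x) ≡ bit (q x) + bit (r x)) →
              count p i ≡ count q i + count r i
count-split zero eq = refl
count-split {p} {q} {r} (suc i) eq = trans
  (cong₂ _+_ (eq ≤-refl) (count-split i (eq ∘ m<n⇒m<1+n)))
  (interchange (bit (q i)) (bit (r i)) (count q i) (count r i))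

module Counting {𝓑 : Word → Set} (linked : IsLinked 𝓑) (S : ℕ → Step) (n : ℕ) where

  open IsLinked linked
  open Codes linked
  open Words S
  open Purity linked S n

  encode : ∀ C K {h} → 𝓑 (C ʳ++ K) → Level C h →
           ∃[ e ] ∃[ σ ] length σ ≡ h × Code {length K} C e σ K
  encode C [] b H with [] ← H b = [] , [] , refl , [] b
  encode C ((col D , false) ∷ K) b H =
    let e , σ , l , c = encode _ K b (level-pass C H) in _ , σ , l , skip c
  encode C ((col D , true) ∷ K) b H with encode _ K b (level-exit C H)
  ... | e , x ∷ σ , l , c = _ , σ , suc-injective l , open′ c
  encode C ((row r , false) ∷ K) b H with push _ ← H b =
    let e , σ , l , c = encode _ K b (level-push C H) in _ , _ , cong suc l , close c
  encode C ((row r , true) ∷ K) b H with encode _ K b (level-stay C H) | avoid? C b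
  ... | e , σ , l , c     | no n = _ , _ , l , keep n c
  ... | e , x ∷ σ , l , c | yes a = _ , _ , l , raise a c
  ... | e , [] , refl , c | yes (_ , a) with () ← H a

  code-of : ∀ {f} → Basisᶠ f → ∃[ e ] Code {n} [] e [] (word f n)
  code-of {f} b with encode [] (word f n) b balanced
  ... | e , [] , _ , c =
    subst (λ i → ∃[ e ] Code {i} [] e [] (word f n)) (word-length f n) (e , c)

  code-injectiveᶠ : ∀ {f g} {e : Vec ℕ n} → Code [] e [] (word f n) → Code [] e [] (word g n) →
                    ∀ {x} → x < n → f x ≡ g x
  code-injectiveᶠ {f} {g} c c′ =
    word-injective n (code-injective (word-labels f g n) c c′)

  isRow : ℕ → Bool
  isRow i with S i
  ... | row _ = true
  ... | col _ = false

  height-count : ∀ f i {h} → Height (word f i) h → count f i + h ≡ count isRow i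
  height-count f zero [] = refl
  height-count f (suc i) H with S i | f i
  height-count f (suc i) (stay H) | row _ | true  = cong suc (height-count f i H)
  height-count f (suc i) (push H) | row _ | false = trans (+-suc _ _) (cong suc (height-count f i H))
  height-count f (suc i) (pass H) | col _ | false = height-count f i H
  height-count f (suc i) (exit H) | col _ | true  = trans (sym (+-suc _ _)) (height-count f i H)

  basis-count : ∀ {f g} → Basisᶠ f → Basisᶠ g → count f n ≡ count g n
  basis-count {f} {g} b b′ = +-cancelʳ-≡ 0 _ _
    (trans (height-count f n (balanced b)) (sym (height-count g n (balanced b′))))

  degree-step : ∀ {i C s b K σ q k} {e : Vec ℕ (suc i)} →
    (q ≡ true → b ≡ true × Free C s) → (b ≡ true → Free C s → q ≡ true) →
    (∀ {e : Vec ℕ i} {σ} → Code ((s , b) ∷ C) e σ K → Vec.sum e + sum σ ≡ k) →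
    Code C e σ ((s , b) ∷ K) → Vec.sum e + sum σ ≡ bit q + k
  degree-step {q = true}  to from rec (skip c) with () ← proj₁ (to refl)
  degree-step {q = false} to from rec (skip c) = rec c
  degree-step {q = true} to from rec (open′ {σ = σ} {x = x} {e = e} c) = cong suc (trans
    (cong (_+ sum σ) (+-comm x (Vec.sum e))) (trans (+-assoc (Vec.sum e) x (sum σ)) (rec c)))
  degree-step {q = false} to from rec (open′ c) with () ← from refl col
  degree-step {q = true} to from rec (keep n c) with row a ← proj₂ (to refl) = contradiction a n
  degree-step {q = false} to from rec (keep n c) = rec c
  degree-step {q = true} to from rec (raise a c) = trans (+-suc _ _) (cong suc (rec c))
  degree-step {q = false} to from rec (raise a c) with () ← from refl (row a)
  degree-step {q = true} to from rec (close c) with () ← proj₁ (to refl)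
  degree-step {q = false} to from rec (close c) = rec c

  module _ (exchange : Exchange) where

    passive-by : ∀ {f g i} → i < n → Basisᶠ f → Basisᶠ g → (∀ {x} → i < x → g x ≡ f x) →
                 f i ≡ true → g i ≡ false → Passiveᶠ f i
    passive-by i<n b b′ eq fi gi =
      let C , A = prefix i<n in free-passive exchange A i<n b fi (free-by A b′ eq gi)

    passive-free : ∀ {f C i} → Above f C (suc i) → Passiveᶠ f i → Free C (S i)
    passive-free {i = i} A p with S i in si
    ... | row r = row (passive-avoidable A si p)
    ... | col D = col

    degree-count : ∀ {f p} → Basisᶠ f → (∀ {x} → x < n → p x ≡ true → f x ≡ true × Passiveᶠ f x) →
      (∀ {x} → x < n → f x ≡ true → Passiveᶠ f x → p x ≡ true) →
      ∀ i {C σ} {e : Vec ℕ i} → i ≤ n → Above f C i → Code C e σ (word f i) →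
      Vec.sum e + sum σ ≡ count p i
    degree-count b to from zero i≤n A ([] _) = refl
    degree-count b to from (suc i) i<n A c = degree-step
      (λ q → let fi , p = to i<n q in fi , passive-free A p)
      (λ fi φ → from i<n fi (free-passive exchange A i<n b fi φ))
      (degree-count b to from i (<⇒≤ i<n) (above-step A refl)) c

    module _ (basis? : ∀ f → Dec (Basisᶠ f)) where

      passiveᶠ? : ∀ f i → Dec (f i ≡ true × Passiveᶠ f i)
      passiveᶠ? f i with f i ≟ᵇ true | anyUpTo? (λ z → f z ≟ᵇ false ×-dec basis? (swap f i z)) i
      ... | yes p | yes q = yes (p , q)
      ... | no ¬p | _     = no (¬p ∘ proj₁)
      ... | _     | no ¬q = no (¬q ∘ proj₂)

      extend : ∀ {f g m μ} {e : Vec ℕ n} → Basisᶠ f → Basisᶠ g → Code [] e [] (word f n) →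
        m < n → S m ≡ row μ → f m ≡ true → g m ≡ false → ¬ Passiveᶠ f m →
        ∃[ e′ ] ∃[ f′ ] Code {n} [] e′ [] (word f′ n) × Pointwise _≤_ e e′ × f′ m ≡ false
      extend {f} {g} {m} b b′ c m<n sm fm gm ¬p with exchange b b′ m<n fm gm
      ... | y , y<n , _ , fy , b″
        with first (λ z → f z ≟ᵇ false ×-dec basis? (swap f m z)) (suc y)
      ... | inj₂ nowhere = contradiction (fy , b″) (nowhere ≤-refl)
      ... | inj₁ (j , j≤y , (fj , bj) , least) = by-cases (<-cmp m j)
        where
        by-cases : Tri (m < j) (m ≡ j) (j < m) → _
        by-cases (tri< m<j m≢j _) =
          let e′ , c′ = code-of bj
              open Swapped exchange b m<j (≤-<-trans (s≤s⁻¹ j≤y) y<n) fm fj sm bj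
                           (λ z<j fz bz → least z<j (fz , bz))
          in e′ , swap f m j , c′ , dominated c c′ , swap-out f m≢j
        by-cases (tri≈ _ refl _) = contradiction fj (true≢false fm)
        by-cases (tri> _ _ j<m)  = contradiction (j , j<m , fj , bj) ¬p

      MaximalCode : Vec ℕ n → Set
      MaximalCode e = ∀ {e′ f′} → Code [] e′ [] (word f′ n) → Pointwise _≤_ e e′ → e′ ≡ e

      maximal-coloop : ∀ {f g i} {e : Vec ℕ n} → Basisᶠ f → Basisᶠ g → Code [] e [] (word f n) →
        MaximalCode e → i < n → f i ≡ true → ¬ Passiveᶠ f i → g i ≡ true
      maximal-coloop {f} {g} {i} {e} b b′ c max i<n fi ¬p with g i in gi | S i in si
      ... | true  | _     = refl
      ... | false | row r =
        let e′ , f′ , c′ , p , f′i = extend b b′ c i<n si fi gi ¬p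
            c″ = subst (λ e → Code [] e [] (word f′ n)) (max {f′ = f′} c′ p) c′
        in contradiction f′i (true≢false (trans (code-injectiveᶠ {f′} {f} c″ c i<n) fi))
      ... | false | col D = contradiction
        (let C , A = prefix i<n in free-passive exchange A i<n b fi (subst (Free C) (sym si) col)) ¬p

      pure : ∀ {f g} {e e′ : Vec ℕ n} → Basisᶠ f → Basisᶠ g →
        Code [] e [] (word f n) → Code [] e′ [] (word g n) → MaximalCode e → MaximalCode e′ →
        Vec.sum e ≡ Vec.sum e′
      pure {f} {g} {e} {e′} b b′ c c′ max max′ = +-cancelʳ-≡ (count (coloop f) n) _ _ (begin
        Vec.sum e + count (coloop f) n       ≡⟨ cong (_+ count (coloop f) n) (sum-passing b c) ⟩
        count (passing f) n + count (coloop f) n ≡⟨ count-split n (λ {x} _ → split-bit f x) ⟨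
        count f n                             ≡⟨ basis-count b b′ ⟩
        count g n                             ≡⟨ count-split n (λ {x} _ → split-bit g x) ⟩
        count (passing g) n + count (coloop g) n ≡⟨ cong₂ _+_ (sym (sum-passing b′ c′))
                                                         (count-cong n same) ⟩
        Vec.sum e′ + count (coloop f) n      ∎)
        where
        open ≡-Reasoning
        passing coloop : (ℕ → Bool) → ℕ → Bool
        passing f i = does (passiveᶠ? f i)
        coloop f i = f i ∧ not (passing f i)
        sum-passing : ∀ {f} {e : Vec ℕ n} → Basisᶠ f → Code [] e [] (word f n) →
                      Vec.sum e ≡ count (passing f) n
        sum-passing {f} b c = trans (sym (+-identityʳ _)) (degree-count b to from n ≤-refl above-top c)
          where
          to : ∀ {x} → x < n → passing f x ≡ true → f x ≡ true × Passiveᶠ f x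
          to {x} _ eq with passiveᶠ? f x
          ... | yes p = p
          from : ∀ {x} → x < n → f x ≡ true → Passiveᶠ f x → passing f x ≡ true
          from {x} _ fx p with passiveᶠ? f x
          ... | yes _ = refl
          ... | no ¬q = contradiction (fx , p) ¬q
        split-bit : ∀ f x → bit (f x) ≡ bit (passing f x) + bit (coloop f x)
        split-bit f x with f x in fx | passiveᶠ? f x
        ... | true  | yes _ = refl
        ... | true  | no _  = refl
        ... | false | yes (() , _)
        ... | false | no _  = refl
        include : ∀ {f g} {e : Vec ℕ n} → Basisᶠ f → Basisᶠ g → Code [] e [] (word f n) →
          MaximalCode e → ∀ {x} → x < n → coloop f x ≡ true → coloop g x ≡ true
        include {f} {g} b b′ c max {x} x<n eq with f x in fx | passiveᶠ? f x | passiveᶠ? g x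
        ... | true | no ¬p | no _ = cong (_∧ true)
          (maximal-coloop b b′ c max x<n fx (λ p → ¬p (refl , p)))
        ... | true | no ¬p | yes (gx , z , z<x , _ , b″) = contradiction
          (maximal-coloop b b″ c max x<n fx (λ p → ¬p (refl , p)))
          (λ q → true≢false q (swap-out g (<⇒≢ z<x ∘ sym)))
        same : ∀ {x} → x < n → coloop g x ≡ coloop f x
        same {x} x<n with coloop f x in p | coloop g x in q
        ... | true  | true  = refl
        ... | false | false = refl
        ... | true  | false = trans (sym q) (include b b′ c max x<n p)
        ... | false | true  = trans (sym (include b′ b c′ max′ x<n q)) p

module _ {A : Set} {P : A → Set} (P? : Decidable P) where

  count-none : ∀ {k} (g : Fin k → A) → (∀ r → ¬ P (g r)) → length (filter P? (tabulate g)) ≡ 0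
  count-none {zero}  g ¬p = refl
  count-none {suc k} g ¬p with P? (g zero)
  ... | yes p = contradiction p (¬p zero)
  ... | no _  = count-none (g ∘ suc) (¬p ∘ suc)

  count-below : ∀ {k} (g : Fin k → A) → (∀ {r r′} → r Fin.≤ r′ → P (g r′) → P (g r)) →
                ∀ r → P (g r) → toℕ r < length (filter P? (tabulate g))
  count-below {suc k} g down r p with P? (g zero)
  count-below {suc k} g down r       p | no ¬p = contradiction (down z≤n p) ¬p
  count-below {suc k} g down zero    p | yes _ = s≤s z≤n
  count-below {suc k} g down (suc r) p | yes _ = s≤s (count-below (g ∘ suc) (down ∘ s≤s) r p)

  count-above : ∀ {k} (g : Fin k → A) → (∀ {r r′} → r Fin.≤ r′ → P (g r′) → P (g r)) →
                ∀ r → ¬ P (g r) → length (filter P? (tabulate g)) ≤ toℕ r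
  count-above {suc k} g down r ¬p with P? (g zero)
  count-above {suc k} g down r       ¬p | no ¬q =
    ≤-trans (≤-reflexive (count-none (g ∘ suc) (λ r p → ¬q (down z≤n p)))) z≤n
  count-above {suc k} g down zero    ¬p | yes q = contradiction q ¬p
  count-above {suc k} g down (suc r) ¬p | yes _ = s≤s (count-above (g ∘ suc) (down ∘ s≤s) r ¬p)

injective⇒surjective : ∀ {m n} → n ≤ m → (g : Fin m → Fin n) → (∀ {x y} → g x ≡ g y → x ≡ y) →
                       ∀ p → ∃[ x ] g x ≡ p
injective⇒surjective {m} {suc n} n<m g inj p with any? (λ x → g x Fin.≟ p)
... | yes found = found
... | no ¬found = contradiction (injective⇒≤ {f = λ x → punchOut (missed x)}
    (λ {x} {y} eq → inj (punchOut-injective (missed x) (missed y) eq)))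
  (<⇒≱ n<m)
  where
  missed : ∀ x → p ≢ g x
  missed x eq = ¬found (x , sym eq)

module Labels {n : ℕ} (L : LeDiagram n) where
  open LeDiagram L

  width : ℕ
  width = n ∸ k

  ρ : Row → ℕ
  ρ r = toℕ (rowLabel r)

  κ : Col → ℕ
  κ c = toℕ (colLabel c)

  ρ-def : ∀ r → ρ r ≡ (width ∸ rowLength r) + toℕ r
  ρ-def r = toℕ-fromℕ< _

  κ-def : ∀ c → κ c ≡ (width ∸ suc (toℕ c)) + colLength c
  κ-def c = toℕ-fromℕ< _

  box⇒below : ∀ {r c} → Box r c → toℕ r < colLength c
  box⇒below {r} {c} = count-below (λ r → toℕ c <? rowLength r) id
    (λ r≤r′ p → <-≤-trans p (decreasing r≤r′)) r

  ¬box⇒above : ∀ {r c} → ¬ Box r c → colLength c ≤ toℕ r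
  ¬box⇒above {r} {c} = count-above (λ r → toℕ c <? rowLength r) id
    (λ r≤r′ p → <-≤-trans p (decreasing r≤r′)) r

  box⇒< : ∀ {r c} → Box r c → ρ r < κ c
  box⇒< {r} {c} b rewrite ρ-def r | κ-def c = +-mono-≤-< (∸-monoʳ-≤ width b) (box⇒below b)

  ¬box⇒> : ∀ {r c} → ¬ Box r c → κ c < ρ r
  ¬box⇒> {r} {c} ¬b rewrite ρ-def r | κ-def c =
    +-mono-<-≤ (∸-monoʳ-< (s≤s (≮⇒≥ ¬b)) (toℕ<n c)) (¬box⇒above ¬b)

  <⇒box : ∀ {r c} → ρ r < κ c → Box r c
  <⇒box {r} {c} lt with toℕ c <? rowLength r
  ... | yes b = b
  ... | no ¬b = contradiction (¬box⇒> ¬b) (<⇒≯ lt)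

  ρ-mono : ∀ {r r′} → r Fin.< r′ → ρ r < ρ r′
  ρ-mono {r} {r′} lt rewrite ρ-def r | ρ-def r′ =
    +-mono-≤-< (∸-monoʳ-≤ width (decreasing (<⇒≤ lt))) lt

  colLength-anti : ∀ {c c′} → c Fin.< c′ → colLength c′ ≤ colLength c
  colLength-anti {c} {c′} lt with colLength c <? colLength c′
  ... | no ≮  = ≮⇒≥ ≮
  ... | yes l = contradiction (subst (_< colLength c) (toℕ-fromℕ< l<k) (box⇒below box)) (<-irrefl refl)
    where
    l<k : colLength c < k
    l<k = <-≤-trans l (≤-trans (length-filter (λ r → toℕ c′ <? rowLength r) (tabulate id))
                               (≤-reflexive (length-tabulate {n = k} id)))
    box′ : Box (fromℕ< l<k) c′
    box′ with toℕ c′ <? rowLength (fromℕ< l<k)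
    ... | yes b = b
    ... | no ¬b = contradiction (¬box⇒above ¬b)
      (<⇒≱ (subst (_< colLength c′) (sym (toℕ-fromℕ< l<k)) l))
    box : Box (fromℕ< l<k) c
    box = <-trans lt box′

  κ-anti : ∀ {c c′} → c Fin.< c′ → κ c′ < κ c
  κ-anti {c} {c′} lt rewrite κ-def c | κ-def c′ =
    +-mono-<-≤ (∸-monoʳ-< (s≤s lt) (toℕ<n c′)) (colLength-anti lt)

  κ-anti⁻¹ : ∀ {c c′} → κ c < κ c′ → c′ Fin.< c
  κ-anti⁻¹ {c} {c′} lt with <-cmp (toℕ c) (toℕ c′)
  ... | tri< l _ _ = contradiction (κ-anti l) (<⇒≯ lt)
  ... | tri≈ _ e _ = contradiction lt (<-irrefl (cong κ (toℕ-injective e)))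
  ... | tri> _ _ l = l

  κ-injective : ∀ {c c′} → κ c ≡ κ c′ → c ≡ c′
  κ-injective {c} {c′} eq with <-cmp (toℕ c) (toℕ c′)
  ... | tri< l _ _ = contradiction (κ-anti l) (<-irrefl (sym eq))
  ... | tri≈ _ e _ = toℕ-injective e
  ... | tri> _ _ l = contradiction (κ-anti l) (<-irrefl eq)

  ρ-injective : ∀ {r r′} → ρ r ≡ ρ r′ → r ≡ r′
  ρ-injective {r} {r′} eq with <-cmp (toℕ r) (toℕ r′)
  ... | tri< l _ _ = contradiction (ρ-mono l) (<-irrefl eq)
  ... | tri≈ _ e _ = toℕ-injective e
  ... | tri> _ _ l = contradiction (ρ-mono l) (<-irrefl (sym eq))

  ρ-mono⁻¹ : ∀ {r r′} → ρ r < ρ r′ → r Fin.< r′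
  ρ-mono⁻¹ {r} {r′} lt with <-cmp (toℕ r) (toℕ r′)
  ... | tri< l _ _ = l
  ... | tri≈ _ e _ = contradiction lt (<-irrefl (cong ρ (toℕ-injective e)))
  ... | tri> _ _ l = contradiction (ρ-mono l) (<⇒≯ lt)

  ρ≢κ : ∀ {r c} → ρ r ≢ κ c
  ρ≢κ {r} {c} eq with toℕ c <? rowLength r
  ... | yes b = <-irrefl eq (box⇒< b)
  ... | no ¬b = <-irrefl (sym eq) (¬box⇒> ¬b)

  label : Fin k ⊎ Fin (n ∸ k) → Fin n
  label (inj₁ r) = rowLabel r
  label (inj₂ c) = colLabel c

  label-injective : ∀ {x y} → label x ≡ label y → x ≡ y
  label-injective {inj₁ r} {inj₁ r′} eq = cong inj₁ (ρ-injective (cong toℕ eq))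
  label-injective {inj₁ r} {inj₂ c}  eq = contradiction (cong toℕ eq) ρ≢κ
  label-injective {inj₂ c} {inj₁ r}  eq = contradiction (cong toℕ (sym eq)) ρ≢κ
  label-injective {inj₂ c} {inj₂ c′} eq = cong inj₂ (κ-injective (cong toℕ eq))

  label-surjective : ∀ p → ∃[ x ] label x ≡ p
  label-surjective p =
    let x , eq = injective⇒surjective (≤-reflexive (sym (m+[n∸m]≡n k≤n)))
                   (label ∘ splitAt k) (λ eq → splitAt-injective (label-injective eq)) p
    in splitAt k x , eq
    where
    splitAt-injective : ∀ {x y : Fin (k + (n ∸ k))} → splitAt k x ≡ splitAt k y → x ≡ y
    splitAt-injective {x} {y} eq = trans (sym (Fin.join-splitAt k (n ∸ k) x))
      (trans (cong (Fin.join k (n ∸ k)) eq) (Fin.join-splitAt k (n ∸ k) y))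

  dots : Col → ℕ → Bool
  dots c a with a <? k
  ... | yes a<k = filling (fromℕ< a<k) c
  ... | no _    = false

  dots⇒dot : ∀ {c a} → T (dots c a) → ∃[ r ] toℕ r ≡ a × Dot r c
  dots⇒dot {c} {a} d with a <? k
  ... | yes a<k = fromℕ< a<k , toℕ-fromℕ< a<k , d

  dot⇒dots : ∀ {r c} → Dot r c → T (dots c (toℕ r))
  dot⇒dots {r} {c} d with toℕ r <? k
  ... | yes r<k = subst (λ r → Dot r c) (sym (fromℕ<-toℕ r r<k)) d
  ... | no ≮k   = contradiction (toℕ<n r) ≮k

  stepOf : Fin k ⊎ Fin (n ∸ k) → Step
  stepOf (inj₁ r) = row (toℕ r)
  stepOf (inj₂ c) = col (dots c)

  -- Positions beyond n carry an irrelevant step.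
  step : ℕ → Step
  step p with p <? n
  ... | yes p<n = stepOf (proj₁ (label-surjective (fromℕ< p<n)))
  ... | no _    = row 0

  step-def : ∀ {p} (p<n : p < n) → step p ≡ stepOf (proj₁ (label-surjective (fromℕ< p<n)))
  step-def {p} p<n with p <? n
  ... | yes p<n′ = cong (λ lt → stepOf (proj₁ (label-surjective (fromℕ< lt)))) (<-irrelevant p<n′ p<n)
  ... | no ≮n    = contradiction p<n ≮n

  data Kind (p : ℕ) : Set where
    row : ∀ r → ρ r ≡ p → step p ≡ row (toℕ r) → Kind p
    col : ∀ c → κ c ≡ p → step p ≡ col (dots c) → Kind p

  kind : ∀ {p} → p < n → Kind p
  kind {p} p<n = classify (label-surjective (fromℕ< p<n)) (step-def p<n)
    where
    classify : (s : ∃[ x ] label x ≡ fromℕ< p<n) → step p ≡ stepOf (proj₁ s) → Kind p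
    classify (inj₁ r , e) eq = row r (trans (cong toℕ e) (toℕ-fromℕ< p<n)) eq
    classify (inj₂ c , e) eq = col c (trans (cong toℕ e) (toℕ-fromℕ< p<n)) eq

∈-setOf⁺ : ∀ {n} {x : Fin n} {xs} → x ∈ˡ xs → x ∈ setOf xs
∈-setOf⁺ (here refl) = x∈p∪q⁺ (inj₁ (x∈⁅x⁆ _))
∈-setOf⁺ (there p)   = x∈p∪q⁺ (inj₂ (∈-setOf⁺ p))

∈-setOf⁻ : ∀ {n} {x : Fin n} xs → x ∈ setOf xs → x ∈ˡ xs
∈-setOf⁻ []       p = contradiction p ∉⊥
∈-setOf⁻ (y ∷ xs) p with x∈p∪q⁻ ⁅ y ⁆ (setOf xs) p
... | inj₁ q = here (x∈⁅y⁆⇒x≡y y q)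
... | inj₂ q = there (∈-setOf⁻ xs q)

allPairs-related : ∀ {A : Set} {R : A → A → Set} → (∀ {x y} → R x y → R y x) → ∀ {xs x y} →
                   AllPairs R xs → x ∈ˡ xs → y ∈ˡ xs → x ≡ y ⊎ R x y
allPairs-related s (rs ∷ ps) (here refl) (here refl) = inj₁ refl
allPairs-related s (rs ∷ ps) (here refl) (there q)   = inj₂ (All.lookup rs q)
allPairs-related s (rs ∷ ps) (there p)   (here refl) = inj₂ (s (All.lookup rs p))
allPairs-related s (rs ∷ ps) (there p)   (there q)   = allPairs-related s ps p q

disjoint-⊆ : ∀ {A : Set} {xs ys xs′ ys′ : List A} → xs′ ⊆ xs → ys′ ⊆ ys →
             Disjoint xs ys → Disjoint xs′ ys′
disjoint-⊆ p q d (x , y) = d (p x , q y)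

allPairs-⊆ : ∀ {A : Set} {xss yss : List (List A)} → Pointwiseˡ _⊆_ yss xss →
             AllPairs Disjoint xss → AllPairs Disjoint yss
allPairs-⊆ []       []         = []
allPairs-⊆ {A} (p ∷ ps) (d ∷ ds) = shrink ps d ∷ allPairs-⊆ ps ds
  where
  shrink : ∀ {xss yss} → Pointwiseˡ _⊆_ yss xss → All (Disjoint _) xss → All (Disjoint _) yss
  shrink []       []       = []
  shrink (q ∷ qs) (d ∷ ds) = disjoint-⊆ p q d ∷ shrink qs ds

data Descending : ℕ → Stack → Set where
  []  : ∀ {u} → Descending u []
  _∷_ : ∀ {u a O} → a < u → Descending a O → Descending u (a ∷ O)

descending-weaken : ∀ {u v O} → u ≤ v → Descending u O → Descending v O
descending-weaken p []       = []
descending-weaken p (q ∷ ds) = <-≤-trans q p ∷ ds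

cross-descending : ∀ {D u A B} → Cross D u A B → Descending u B
cross-descending []           = []
cross-descending (cons q m t) = q ∷ descending-weaken (move-≤ m) (cross-descending t)

upward : (ℕ → Step) → (ℕ → Bool) → ℕ → ℕ → Word
upward S f p zero    = []
upward S f p (suc d) = (S p , f p) ∷ upward S f (suc p) d

module Graph {n : ℕ} (L : LeDiagram n) where
  open LeDiagram L
  open LeGraph L
  open Labels L

  start-row : ∀ {u v} → TransClosure _⟶_ u v → ∀ {s} → u ≡ boundary s → ∃[ r ] s ≡ rowLabel r
  start-row [ enter d _ ]   refl = _ , refl
  start-row (enter d _ ∷ _) refl = _ , refl

  no-sink : ∀ {c v} → ¬ TransClosure _⟶_ (boundary (colLabel c)) v
  no-sink es with start-row es refl
  ... | r , eq = ρ≢κ (sym (cong toℕ eq))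

  end-col : ∀ {u v} → TransClosure _⟶_ u v → ∀ {e} → v ≡ boundary e → ∃[ c ] e ≡ colLabel c
  end-col [ exit d _ ] refl = _ , refl
  end-col (_ ∷ es)     eq   = end-col es eq

  potential : Vertex → ℕ
  potential (boundary x) = toℕ x
  potential (dot r c _)  = κ c

  edge-potential : ∀ {u v} → u ⟶ v → potential u ≤ potential v
  edge-potential (enter d _)      = <⇒≤ (box⇒< (dot⇒box d))
  edge-potential (left _ _ lt _)  = <⇒≤ (κ-anti lt)
  edge-potential (down _ _ _ _)   = ≤-refl
  edge-potential (exit _ _)       = ≤-refl

  walk-potential : ∀ {u v} → TransClosure _⟶_ u v → potential u ≤ potential v
  walk-potential [ e ]    = edge-potential e
  walk-potential (e ∷ es) = ≤-trans (edge-potential e) (walk-potential es)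

  record Describes (f : ℕ → Bool) (ps : List Path) : Set where
    field
      started : ∀ {r} → rowLabel r ∈ˡ map start ps → f (ρ r) ≡ false
      unused  : ∀ {r} → f (ρ r) ≡ false → rowLabel r ∈ˡ map start ps
      ended   : ∀ {c} → colLabel c ∈ˡ map end ps → f (κ c) ≡ true
      reached : ∀ {c} → f (κ c) ≡ true → colLabel c ∈ˡ map end ps

  -- From path families to runs

  data Followed {r c d e} (es : TransClosure _⟶_ (dot r c d) (boundary e)) : Set where
    leaves : ∀ {r′ c′} {d″ : Dot r′ c′} (es′ : TransClosure _⟶_ (dot r′ c′ d″) (boundary e)) →
             r Fin.≤ r′ → Dot r′ c → c′ Fin.< c →
             (∀ {c″} → c′ Fin.< c″ → c″ Fin.< c → ¬ Dot r′ c″) →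
             (∀ {r″} d″ → r Fin.≤ r″ → r″ Fin.≤ r′ → dot r″ c d″ ∈ˡ visited es) →
             visited es′ ⊆ visited es → Followed es
    exits  : e ≡ colLabel c → (∀ {r″} d″ → r Fin.≤ r″ → dot r″ c d″ ∈ˡ visited es) → Followed es

  at-row : ∀ {r r′ c} {d : Dot r c} {d′ : Dot r′ c} → toℕ r′ ≡ toℕ r → dot r′ c d′ ≡ dot r c d
  at-row {d = d} {d′} eq with toℕ-injective eq
  ... | refl = cong (dot _ _) (T-irrelevant d′ d)

  follow : ∀ {r c d e} (es : TransClosure _⟶_ (dot r c d) (boundary e)) → Followed es
  follow {r} [ exit d none ] = exits refl covered
    where
    covered : ∀ {r″} d″ → r Fin.≤ r″ → _
    covered d″ le with m≤n⇒m<n∨m≡n le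
    ... | inj₁ lt = contradiction d″ (none lt)
    ... | inj₂ eq = here (at-row (sym eq))
  follow (exit d _ ∷ es) = contradiction es no-sink
  follow (left d d′ lt none ∷ es) =
    leaves es ≤-refl d′ lt none (λ d″ p q → here (at-row (≤-antisym q p))) there
  follow {r} (down {r′ = r₁} d d′ lt none ∷ es) with follow es
  ... | exits eq cover = exits eq covered
    where
    covered : ∀ {r″} d″ → r Fin.≤ r″ → _
    covered {r″} d″ le with m≤n⇒m<n∨m≡n le | toℕ r″ <? toℕ r₁
    ... | inj₂ eq | _      = here (at-row (sym eq))
    ... | inj₁ gt | yes l  = contradiction d″ (none gt l)
    ... | inj₁ gt | no ≮   = there (cover d″ (≮⇒≥ ≮))
  ... | leaves {r′} es′ le d₁ lt′ none′ cover sub =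
    leaves es′ (≤-trans (<⇒≤ lt) le) d₁ lt′ none′ covered (there ∘ sub)
    where
    covered : ∀ {r″} d″ → r Fin.≤ r″ → r″ Fin.≤ r′ → _
    covered {r″} d″ p q with m≤n⇒m<n∨m≡n p | toℕ r″ <? toℕ r₁
    ... | inj₂ eq | _      = here (at-row (sym eq))
    ... | inj₁ gt | yes l  = contradiction d″ (none gt l)
    ... | inj₁ gt | no ≮   = there (cover d″ (≮⇒≥ ≮) q)

  module FromPaths (f : ℕ → Bool) (ps : List Path) (nt : NonTouching ps) (desc : Describes f ps) where
    open Describes desc

    -- A path that runs along row a when the labels below p have been processed; only
    -- its part from its next dot on is recorded.
    record Live (p a : ℕ) : Set where
      field
        {r}    : Row
        {c}    : Col
        {d}    : Dot r c
        origin : Path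
        member : origin ∈ˡ ps
        edges′ : TransClosure _⟶_ (dot r c d) (boundary (end origin))
        at     : toℕ r ≡ a
        seen   : ρ r < p
        older  : toℕ (start origin) < p
        ahead  : p ≤ κ c
        gap    : ∀ {c″} → c Fin.< c″ → p ≤ κ c″ → ¬ Dot r c″
        within : visited edges′ ⊆ vertices origin

    open Live

    trace : ∀ {p a} → Live p a → List Vertex
    trace l = visited (edges′ l)

    traces : ∀ {p O} → All (Live p) O → List (List Vertex)
    traces []       = []
    traces (l ∷ ls) = trace l ∷ traces ls

    targets : ∀ {p O} → All (Live p) O → List (Fin n)
    targets []       = []
    targets (l ∷ ls) = end (origin l) ∷ targets ls

    data Outcome {p a} (c₀ : Col) (l : Live p a) : Set where
      straight : (∀ {r} → r ≤ a → ¬ T (dots c₀ r)) → (l′ : Live (suc p) a) →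
                 trace l′ ⊆ trace l → end (origin l′) ≡ end (origin l) → Outcome c₀ l
      turned   : ∀ {b} → a ≤ b → T (dots c₀ a) → T (dots c₀ b) → (l′ : Live (suc p) b) →
                 trace l′ ⊆ trace l → end (origin l′) ≡ end (origin l) →
                 (∀ {r} d → a ≤ toℕ r → toℕ r ≤ b → dot r c₀ d ∈ˡ trace l) → Outcome c₀ l
      exited   : T (dots c₀ a) → end (origin l) ≡ colLabel c₀ →
                 (∀ {r} d → a ≤ toℕ r → dot r c₀ d ∈ˡ trace l) → Outcome c₀ l

    advance : ∀ {p a c₀} → κ c₀ ≡ p → (l : Live p a) → Outcome c₀ l
    advance {c₀ = c₀} refl l@record { r = r ; c = c ; d = d } with c Fin.≟ c₀
    ... | no c≢c₀ = straight no-dots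
      record { Live l ; seen = m<n⇒m<1+n (seen l) ; older = m<n⇒m<1+n (older l)
             ; ahead = κ< ; gap = λ lt le → gap l lt (<⇒≤ le) } id refl
      where
      κ< : κ c₀ < κ c
      κ< = ≤∧≢⇒< (ahead l) (c≢c₀ ∘ κ-injective ∘ sym)
      c<c₀ : c Fin.< c₀
      c<c₀ = κ-anti⁻¹ κ<
      empty : ¬ Dot r c₀
      empty = gap l c<c₀ ≤-refl
      no-dots : ∀ {r′} → r′ ≤ _ → ¬ T (dots c₀ r′)
      no-dots r′≤a dot′ with dots⇒dot dot′
      ... | r′ , refl , d′ with m≤n⇒m<n∨m≡n (≤-trans r′≤a (≤-reflexive (sym (at l))))
      ...   | inj₁ lt = empty (le (<⇒box (seen l)) (dot⇒box d′) (dot⇒box d) lt c<c₀ d′ d)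
      ...   | inj₂ eq = empty (subst (λ r → Dot r c₀) (toℕ-injective eq) d′)
    ... | yes refl with follow (edges′ l)
    ...   | exits eq cover = exited (subst (T ∘ dots c) (at l) (dot⇒dots d)) eq
      (λ d′ le → cover d′ (≤-trans (≤-reflexive (at l)) le))
    ...   | leaves es′ r≤r′ d₁ lt none cover sub = turned
      (≤-trans (≤-reflexive (sym (at l))) r≤r′)
      (subst (T ∘ dots c) (at l) (dot⇒dots d)) (dot⇒dots d₁)
      record { origin = origin l ; member = member l ; edges′ = es′ ; at = refl
             ; seen = m<n⇒m<1+n (box⇒< (dot⇒box d₁)) ; older = m<n⇒m<1+n (older l)
             ; ahead = κ-anti lt ; gap = λ lt′ le → none lt′ (κ-anti⁻¹ le)
             ; within = within l ∘ sub }
      sub refl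
      (λ d′ le → cover d′ (≤-trans (≤-reflexive (at l)) le))

    -- What keeps a higher path from leaving column c in or below row x.
    Barrier : Col → ℕ → List Vertex → Set
    Barrier c x vs = (∀ {r} → r ≤ x → ¬ T (dots c r)) ⊎
                     (∃[ r ] Σ[ d ∈ Dot r c ] toℕ r ≡ x × dot r c d ∈ˡ vs)

    record Crossed {p O} (c : Col) (x : ℕ) (ls : All (Live p) O) : Set where
      constructor crossed
      field
        {O′}  : Stack
        cross : Cross (dots c) x O O′
        lives : All (Live (suc p)) O′
        sub   : Pointwiseˡ _⊆_ (traces lives) (traces ls)
        same  : targets lives ≡ targets ls

    barrier-at : ∀ {p a c₀} {l : Live p a} → T (dots c₀ a) →
                 (∀ {r} d → a ≤ toℕ r → toℕ r ≤ a → dot r c₀ d ∈ˡ trace l) → Barrier c₀ a (trace l)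
    barrier-at da cover with dots⇒dot da
    ... | r , refl , d = inj₂ (r , d , refl , cover d ≤-refl ≤-refl)

    no-passing : ∀ {c x vs a ws} → Barrier c x vs → a < x → T (dots c a) →
                 (∀ {r} d → a ≤ toℕ r → toℕ r ≤ x → dot r c d ∈ˡ ws) → ¬ Disjoint vs ws
    no-passing (inj₁ none)               a<x da cover dj = none (<⇒≤ a<x) da
    no-passing (inj₂ (r , d , refl , v)) a<x da cover dj = dj (v , cover d (<⇒≤ a<x) ≤-refl)

    cross-below : ∀ {p c₀ x vs O} → κ c₀ ≡ p → Barrier c₀ x vs → Descending x O →
                  (ls : All (Live p) O) → AllPairs Disjoint (vs ∷ traces ls) → Crossed c₀ x ls
    cross-below eq bar [] [] ds = crossed [] [] [] refl
    cross-below eq bar (a<x ∷ desc) (l ∷ ls) ((dj ∷ _) ∷ ds) with advance eq l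
    ... | straight nd l′ sub e =
      let crossed c ls′ subs es = cross-below eq (inj₁ nd) desc ls ds
      in crossed (cons a<x (straight nd) c) (l′ ∷ ls′) (sub ∷ subs) (cong₂ _∷_ e es)
    ... | turned {b} a≤b da db l′ sub e cover =
      let crossed c ls′ subs es = cross-below eq
            (barrier-at {l = l} da (λ d p q → cover d p (≤-trans q a≤b))) desc ls ds
      in crossed (cons b<x (turn a≤b da db) c) (l′ ∷ ls′) (sub ∷ subs) (cong₂ _∷_ e es)
      where
      b<x : b < _
      b<x = ≰⇒> (λ x≤b → no-passing bar a<x da (λ d p q → cover d p (≤-trans q x≤b)) dj)
    ... | exited da _ cover = ⊥-elim (no-passing bar a<x da (λ d p _ → cover d p) dj)

    bump : ∀ {p a r} → ρ r ≡ p → Live p a → Live (suc p) a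
    bump refl l = record { Live l ; seen = m<n⇒m<1+n (seen l) ; older = m<n⇒m<1+n (older l)
                         ; ahead = ≤∧≢⇒< (ahead l) ρ≢κ ; gap = λ lt le → gap l lt (<⇒≤ le) }

    bumps : ∀ {p O r} → ρ r ≡ p → All (Live p) O → All (Live (suc p)) O
    bumps eq = All.map (bump eq)

    bumps-traces : ∀ {p O r} (eq : ρ r ≡ p) (ls : All (Live p) O) → traces (bumps eq ls) ≡ traces ls
    bumps-traces refl []       = refl
    bumps-traces refl (l ∷ ls) = cong (_ ∷_) (bumps-traces refl ls)

    bumps-targets : ∀ {p O r} (eq : ρ r ≡ p) (ls : All (Live p) O) → targets (bumps eq ls) ≡ targets ls
    bumps-targets refl []       = refl
    bumps-targets refl (l ∷ ls) = cong (_ ∷_) (bumps-targets refl ls)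

    Complete : ∀ {p O} → All (Live p) O → Set
    Complete {p} ls = ∀ {q} → q ∈ˡ ps → toℕ (start q) < p → end q ∈ˡ targets ls ⊎ toℕ (end q) < p

    start<end : ∀ (q : Path) → toℕ (start q) < toℕ (end q)
    start<end q with start-row (edges q) refl | end-col (edges q) refl
    ... | r , s | c , e = ≤∧≢⇒< (walk-potential (edges q))
      (λ eq → ρ≢κ (trans (sym (cong toℕ s)) (trans eq (cong toℕ e))))

    live-target : ∀ {p O x} (ls : All (Live p) O) → x ∈ˡ targets ls → p ≤ toℕ x
    live-target (l ∷ ls) (here refl) = ≤-trans (ahead l) (walk-potential (edges′ l))
    live-target (l ∷ ls) (there m)   = live-target ls m

    apart : ∀ {q q′} → q ∈ˡ ps → q′ ∈ˡ ps → q ≡ q′ ⊎ Disjoint (vertices q) (vertices q′)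
    apart = allPairs-related {R = λ p q → Disjoint (vertices p) (vertices q)}
                             (λ d (x , y) → d (y , x)) nt

    same-start : ∀ {q q′} → q ∈ˡ ps → q′ ∈ˡ ps → start q ≡ start q′ → q ≡ q′
    same-start {q} {q′} m m′ eq with apart m m′
    ... | inj₁ e = e
    ... | inj₂ d = ⊥-elim (d (source-visited (edges q) ,
      subst (λ x → boundary x ∈ˡ vertices q′) (sym eq) (source-visited (edges q′))))
      where
      source-visited : ∀ {u v} (es : TransClosure _⟶_ u v) → u ∈ˡ visited es
      source-visited [ _ ]   = here refl
      source-visited (_ ∷ _) = here refl

    enter-path : ∀ {s e} (es : TransClosure _⟶_ (boundary s) (boundary e)) →
      ∃[ r ] ∃[ c ] Σ[ d ∈ Dot r c ] s ≡ rowLabel r × (∀ {c″} → c Fin.< c″ → ¬ Dot r c″) ×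
      Σ[ es′ ∈ TransClosure _⟶_ (dot r c d) (boundary e) ] visited es′ ⊆ visited es
    enter-path (enter d none ∷ es) = _ , _ , d , refl , none , es , there

    seen-below : ∀ {p O r} → ρ r ≡ p → All (Live p) O → All (_< toℕ r) O
    seen-below refl = All.map (λ l → subst (_< _) (at l) (ρ-mono⁻¹ (seen l)))

    run : ∀ d {p u O} → p + d ≡ n → (ls : All (Live p) O) → Descending u O →
          AllPairs Disjoint (traces ls) → Complete ls → Rest (upward step f p d) O
    run zero eq [] _ _ _ = []
    run zero eq (l ∷ _) _ _ _ = contradiction (ahead l)
      (<⇒≱ (<-≤-trans (toℕ<n (colLabel (Live.c l))) (≤-reflexive (trans (sym eq) (+-identityʳ _)))))
    run (suc d) {p} {O = O} eq ls desc ds comp with kind (<-≤-trans (m<m+n p (s≤s z≤n)) (≤-reflexive eq))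
    ... | row r refl sp =
      subst (λ s → Rest ((s , f p) ∷ upward step f (suc p) d) O) (sym sp) (at-row-step (f p) refl)
      where
      at-row-step : ∀ b → f p ≡ b → Rest ((row (toℕ r) , b) ∷ upward step f (suc p) d) O
      at-row-step true fp = stay (seen-below refl ls)
        (run d (trans (sym (+-suc p d)) eq) (bumps {r = r} refl ls) desc
          (subst (AllPairs Disjoint) (sym (bumps-traces {r = r} refl ls)) ds) comp′)
        where
        comp′ : Complete (bumps {r = r} refl ls)
        comp′ {q} m lt with m≤n⇒m<n∨m≡n (s≤s⁻¹ lt)
        ... | inj₂ e = contradiction fp (λ t → true≢false t
          (started (subst (_∈ˡ map start ps) (toℕ-injective e) (∈-map⁺ start m))))
        ... | inj₁ lt′ with comp m lt′
        ...   | inj₁ i = inj₁ (subst (end q ∈ˡ_) (sym (bumps-targets {r = r} refl ls)) i)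
        ...   | inj₂ l = inj₂ (m<n⇒m<1+n l)
      at-row-step false fp with ∈-map⁻ start (unused fp)
      ... | q , m , sq with enter-path (edges q)
      ... | r′ , c , d₁ , sq′ , none , es , sub with ρ-injective (cong toℕ (trans sq sq′))
      ... | refl = push (seen-below refl ls)
        (run d (trans (sym (+-suc p d)) eq) (l₀ ∷ bumps {r = r} refl ls)
          (≤-refl ∷ descend (seen-below refl ls) desc)
          (fresh ls ∷ subst (AllPairs Disjoint) (sym (bumps-traces {r = r} refl ls)) ds)
          comp′)
        where
        l₀ : Live (suc p) (toℕ r)
        l₀ = record { origin = q ; member = m ; edges′ = es ; at = refl ; seen = ≤-refl
                    ; older = ≤-reflexive (cong suc (cong toℕ (sym sq)))
                    ; ahead = box⇒< (dot⇒box d₁) ; gap = λ lt _ → none lt ; within = sub }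
        descend : ∀ {u v O} → All (_< v) O → Descending u O → Descending v O
        descend []       []       = []
        descend (p ∷ _) (_ ∷ ds) = p ∷ ds
        fresh : ∀ {O} (ls : All (Live p) O) → All (Disjoint (visited es)) (traces (bumps {r = r} refl ls))
        fresh [] = []
        fresh (l ∷ ls) with apart m (member l)
        ... | inj₂ dj   = disjoint-⊆ sub (within l) dj ∷ fresh ls
        ... | inj₁ refl = contradiction (older l) (<-irrefl (cong toℕ (sym sq)))
        comp′ : Complete (l₀ ∷ bumps {r = r} refl ls)
        comp′ {q′} m′ lt with m≤n⇒m<n∨m≡n (s≤s⁻¹ lt)
        ... | inj₂ e = inj₁ (here (cong end (same-start m′ m (toℕ-injective (trans e (cong toℕ sq))))))
        ... | inj₁ lt′ with comp m′ lt′
        ...   | inj₁ i = inj₁ (there (subst (end q′ ∈ˡ_) (sym (bumps-targets {r = r} refl ls)) i))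
        ...   | inj₂ l = inj₂ (m<n⇒m<1+n l)
    ... | col c refl sp =
      subst (λ s → Rest ((s , f p) ∷ upward step f (suc p) d) O) (sym sp)
            (at-col-step ls desc ds comp)
      where
      next : ∀ {u O} (ls : All (Live (suc p)) O) → Descending u O → AllPairs Disjoint (traces ls) →
             Complete ls → Rest (upward step f (suc p) d) O
      next = run d (trans (sym (+-suc p d)) eq)
      older-start : ∀ {q : Path} → toℕ (start q) < suc p → toℕ (start q) < p
      older-start {q} lt = ≤∧≢⇒< (s≤s⁻¹ lt)
        (λ e → ρ≢κ (trans (cong toℕ (sym (proj₂ (start-row (edges q) refl)))) e))
      skipped : ∀ {O x} {ls : All (Live p) O} → Complete ls → (cr : Crossed c x ls) → f p ≡ false
      skipped comp cr with f p in fp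
      ... | false = refl
      ... | true with ∈-map⁻ end (reached fp)
      ...   | q , m , eq′ with comp m (<-≤-trans (start<end q) (≤-reflexive (cong toℕ (sym eq′))))
      ...     | inj₂ lt = contradiction lt (<-irrefl (cong toℕ (sym eq′)))
      ...     | inj₁ i  = contradiction
        (live-target (Crossed.lives cr) (subst (end q ∈ˡ_) (sym (Crossed.same cr)) i))
        (<⇒≱ (s≤s (≤-reflexive (cong toℕ (sym eq′)))))
      keep-complete : ∀ {O x} {ls : All (Live p) O} → Complete ls → (cr : Crossed c x ls) →
                      Complete (Crossed.lives cr)
      keep-complete comp cr {q} m lt with comp m (older-start {q} lt)
      ... | inj₁ i = inj₁ (subst (end q ∈ˡ_) (sym (Crossed.same cr)) i)
      ... | inj₂ l = inj₂ (m<n⇒m<1+n l)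
      go-on : ∀ {O x} {ls : All (Live p) O} → AllPairs Disjoint (traces ls) → Complete ls → Crossed c x ls →
              Rest ((col (dots c) , f p) ∷ upward step f (suc p) d) O
      go-on {O} ds comp cr = subst (λ b → Rest ((col (dots c) , b) ∷ upward step f (suc p) d) O)
        (sym (skipped comp cr))
        (pass (Crossed.cross cr) (next (Crossed.lives cr) (cross-descending (Crossed.cross cr))
          (allPairs-⊆ (Crossed.sub cr) ds) (keep-complete comp cr)))
      at-col-step : ∀ {u O} (ls : All (Live p) O) → Descending u O → AllPairs Disjoint (traces ls) →
                    Complete ls → Rest ((col (dots c) , f p) ∷ upward step f (suc p) d) O
      at-col-step [] _ ds comp = go-on ds comp (crossed {x = 0} [] [] [] refl)
      at-col-step (l ∷ ls) (_ ∷ desc) ds comp with advance refl l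
      ... | straight nd l′ sub e =
        let crossed cr ls′ subs es = cross-below refl (inj₁ nd) desc ls ds
        in go-on {ls = l ∷ ls} ds comp
             (crossed (cons ≤-refl (straight nd) cr) (l′ ∷ ls′) (sub ∷ subs) (cong₂ _∷_ e es))
      ... | turned a≤b da db l′ sub e cover =
        let crossed cr ls′ subs es = cross-below refl
              (barrier-at {l = l} da (λ d p q → cover d p (≤-trans q a≤b))) desc ls ds
        in go-on {ls = l ∷ ls} ds comp
             (crossed (cons ≤-refl (turn a≤b da db) cr) (l′ ∷ ls′) (sub ∷ subs) (cong₂ _∷_ e es))
      ... | exited da e cover with cross-below refl (barrier-at {l = l} da (λ d p _ → cover d p)) desc ls ds
      ... | cr = subst (λ b → Rest ((col (dots c) , b) ∷ upward step f (suc p) d) _)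
        (sym (ended (subst (_∈ˡ map end ps) e (∈-map⁺ end (member l)))))
        (exit da (Crossed.cross cr) (next (Crossed.lives cr) (cross-descending (Crossed.cross cr))
          (allPairs-⊆ (Crossed.sub cr) (AllPairs.tail ds)) complete′))
        where
        complete′ : Complete (Crossed.lives cr)
        complete′ {q} m lt with comp m (older-start {q} lt)
        ... | inj₁ (here eq′) = inj₂ (s≤s (≤-reflexive (trans (cong toℕ eq′) (cong toℕ e))))
        ... | inj₁ (there i)  = inj₁ (subst (end q ∈ˡ_) (sym (Crossed.same cr)) i)
        ... | inj₂ l          = inj₂ (m<n⇒m<1+n l)

    complete-run : Rest (upward step f 0 n) []
    complete-run = run n refl [] ([] {u = 0}) [] (λ _ ())

-- From runs to path families

module FromRun {n : ℕ} (L : LeDiagram n) (f : ℕ → Bool) where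
  open LeDiagram L
  open LeGraph L
  open Labels L
  open Graph L

  -- The vertex u is the last one in row a before the columns labelled p or more.
  At : ℕ → ℕ → Vertex → Set
  At p a u = ∀ {r c} → toℕ r ≡ a → (d : Dot r c) → p ≤ κ c →
             (∀ {c″} → c Fin.< c″ → p ≤ κ c″ → ¬ Dot r c″) → u ⟶ dot r c d

  record Tail (p a : ℕ) : Set where
    constructor tail
    field
      target : Fin n
      rest   : List Vertex
      walk   : ∀ {u} → At p a u → Σ[ es ∈ TransClosure _⟶_ u (boundary target) ] visited es ≡ u ∷ rest
  open Tail

  rests : ∀ {p O} → All (Tail p) O → List (List Vertex)
  rests []       = []
  rests (t ∷ ts) = rest t ∷ rests ts

  targets : ∀ {p O} → All (Tail p) O → List (Fin n)
  targets []       = []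
  targets (t ∷ ts) = target t ∷ targets ts

  at-start : ∀ r → At (suc (ρ r)) (toℕ r) (boundary (rowLabel r))
  at-start r eq d le gap with toℕ-injective eq
  ... | refl = enter d (λ lt d″ → gap lt (box⇒< (dot⇒box d″)) d″)

  at-row-label : ∀ {r a u} → At (ρ r) a u → At (suc (ρ r)) a u
  at-row-label at eq d le gap = at eq d (<⇒≤ le) (λ lt le′ → gap lt (≤∧≢⇒< le′ ρ≢κ))

  at-col-label : ∀ {c a u} → ¬ T (dots c a) → At (κ c) a u → At (suc (κ c)) a u
  at-col-label {c} ¬d at refl d le gap = at refl d (<⇒≤ le) gap′
    where
    gap′ : ∀ {c″} → _ → κ c ≤ κ c″ → ¬ Dot _ c″
    gap′ lt le′ d″ with m≤n⇒m<n∨m≡n le′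
    ... | inj₁ lt′ = gap lt lt′ d″
    ... | inj₂ eq with κ-injective eq
    ...   | refl = ¬d (dot⇒dots d″)

  at-dot : ∀ {r c} (d : Dot r c) → At (suc (κ c)) (toℕ r) (dot r c d)
  at-dot d eq d′ le gap with toℕ-injective eq
  ... | refl = left d′ d (κ-anti⁻¹ le) (λ lt lt′ → gap lt (κ-anti lt′))

  enter-dot : ∀ {r c u} → At (κ c) (toℕ r) u → (d : Dot r c) → u ⟶ dot r c d
  enter-dot at d = at refl d ≤-refl (λ lt le _ → <⇒≱ (κ-anti lt) le)

  -- The vertices added to a path when it crosses column c.
  Fresh : Col → ℕ → ℕ → Vertex → Set
  Fresh c a u v = ∃[ r ] Σ[ d ∈ Dot r c ] v ≡ dot r c d × a ≤ toℕ r × toℕ r < u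

  fresh-weaken : ∀ {c a a′ u v} → a ≤ a′ → Fresh c a′ u v → Fresh c a u v
  fresh-weaken p (r , d , eq , q , s) = r , d , eq , ≤-trans p q , s

  next-dot : ∀ c a u →
    (∃[ r ] Dot r c × a < toℕ r × toℕ r < u × (∀ {z} → a < toℕ z → z Fin.< r → ¬ Dot z c)) ⊎
    (∀ {z} → a < toℕ z → toℕ z < u → ¬ Dot z c)
  next-dot c a u with first (λ z → a <? z ×-dec T? (dots c z)) u
  ... | inj₂ none = inj₂ (λ p q d → none q (p , dot⇒dots d))
  ... | inj₁ (j , j<u , (a<j , dj) , least) with dots⇒dot dj
  ...   | r , refl , d = inj₁ (r , d , a<j , j<u , λ p q d → least q (p , dot⇒dots d))

  record Descent {c r} (d : Dot r c) (u : ℕ) (w : Vertex) (post : List Vertex) : Set where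
    constructor descent
    field
      {pre}   : List Vertex
      fresh   : All (Fresh c (toℕ r) u) pre
      edges′  : TransClosure _⟶_ (dot r c d) w
      visits  : visited edges′ ≡ dot r c d ∷ (pre ++ post)

  descend : ∀ g {c r r′ w post} (d : Dot r c) (d′ : Dot r′ c) → toℕ r ≤ toℕ r′ → toℕ r′ ≤ g + toℕ r →
            (es : TransClosure _⟶_ (dot r′ c d′) w) → visited es ≡ dot r′ c d′ ∷ post →
            Descent d (suc (toℕ r′)) w post
  descend g {c} {r} {r′} d d′ r≤r′ enough es eq with next-dot c (toℕ r) (suc (toℕ r′))
  ... | inj₂ none with m≤n⇒m<n∨m≡n r≤r′
  ...   | inj₁ lt = contradiction d′ (none lt ≤-refl)
  ...   | inj₂ e with toℕ-injective e
  ...     | refl with T-irrelevant d d′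
  ...       | refl = descent [] es eq
  descend zero {r = r} d d′ r≤r′ enough es eq | inj₁ (r₁ , _ , r<r₁ , r₁≤r′ , _) =
    contradiction (<-≤-trans r<r₁ (≤-trans (s≤s⁻¹ r₁≤r′) enough)) (<-irrefl refl)
  descend (suc g) {r = r} d d′ r≤r′ enough es eq | inj₁ (r₁ , d₁ , r<r₁ , r₁≤r′ , none)
    with descend g d₁ d′ (s≤s⁻¹ r₁≤r′)
           (≤-trans enough (≤-trans (≤-reflexive (sym (+-suc g (toℕ r)))) (+-monoʳ-≤ g r<r₁))) es eq
  ... | descent fr es′ eq′ = descent
    ((r₁ , d₁ , refl , <⇒≤ r<r₁ , r₁≤r′) ∷ All.map (fresh-weaken (<⇒≤ r<r₁)) fr)
    (down d d₁ r<r₁ none ∷ es′) (cong (dot _ _ d ∷_) eq′)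

  leave : ∀ g {c r} (d : Dot r c) → k ≤ g + toℕ r →
          Descent d k (boundary (colLabel c)) (boundary (colLabel c) ∷ [])
  leave g {c} {r} d enough with next-dot c (toℕ r) k
  ... | inj₂ none = descent [] [ exit d (λ {r″} lt → none lt (toℕ<n r″)) ] refl
  leave zero {r = r} d enough | inj₁ _ = contradiction (toℕ<n r) (≤⇒≯ enough)
  leave (suc g) {r = r} d enough | inj₁ (r₁ , d₁ , r<r₁ , _ , none)
    with leave g d₁ (≤-trans enough (≤-trans (≤-reflexive (sym (+-suc g (toℕ r)))) (+-monoʳ-≤ g r<r₁)))
  ... | descent fr es′ eq′ = descent
    ((r₁ , d₁ , refl , <⇒≤ r<r₁ , toℕ<n r₁) ∷ All.map (fresh-weaken (<⇒≤ r<r₁)) fr)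
    (down d d₁ r<r₁ none ∷ es′) (cong (dot _ _ d ∷_) eq′)

  turn-tail : ∀ {c a b u} → a ≤ b → b < u → T (dots c a) → T (dots c b) →
              (t : Tail (suc (κ c)) b) → Σ[ t′ ∈ Tail (κ c) a ] target t′ ≡ target t ×
              (∀ {v} → v ∈ˡ rest t′ → v ∈ˡ rest t ⊎ Fresh c a u v)
  turn-tail {c} {a} {b} {u} a≤b b<u da db (tail e R w) with dots⇒dot da | dots⇒dot db
  ... | r , refl , d | r′ , refl , d′ with w (at-dot d′)
  ... | es , eq with descend (toℕ r′) d d′ a≤b (m≤m+n _ _) es eq
  ... | descent {pre} fr es′ eq′ =
    tail e (dot r c d ∷ (pre ++ R)) (λ at → (enter-dot at d ∷ es′) , cong (_ ∷_) eq′) , refl , classify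
    where
    classify : ∀ {v} → v ∈ˡ dot r c d ∷ (pre ++ R) → v ∈ˡ R ⊎ Fresh c (toℕ r) u v
    classify (here refl) = inj₂ (r , d , refl , ≤-refl , ≤-<-trans a≤b b<u)
    classify (there m) with ∈-++⁻ pre m
    ... | inj₂ q = inj₁ q
    ... | inj₁ q with All.lookup fr q
    ...   | r″ , d″ , e , p , lt = inj₂ (r″ , d″ , e , p , ≤-<-trans (s≤s⁻¹ lt) b<u)

  exit-tail : ∀ {c a} → T (dots c a) → Σ[ t ∈ Tail (κ c) a ] target t ≡ colLabel c ×
              (∀ {v} → v ∈ˡ rest t → v ≡ boundary (colLabel c) ⊎ Fresh c a k v)
  exit-tail {c} da with dots⇒dot da
  ... | r , refl , d with leave k d (m≤m+n k (toℕ r))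
  ... | descent {pre} fr es′ eq′ =
    tail (colLabel c) (dot r c d ∷ (pre ++ boundary (colLabel c) ∷ []))
         (λ at → (enter-dot at d ∷ es′) , cong (_ ∷_) eq′) , refl , classify
    where
    classify : ∀ {v} → v ∈ˡ dot r c d ∷ (pre ++ boundary (colLabel c) ∷ []) →
               v ≡ boundary (colLabel c) ⊎ Fresh c (toℕ r) k v
    classify (here refl) = inj₂ (r , d , refl , ≤-refl , toℕ<n r)
    classify (there m) with ∈-++⁻ pre m
    ... | inj₂ (here e) = inj₁ e
    ... | inj₁ q = inj₂ (All.lookup fr q)

  data Extends (c : Col) : ℕ → List (List Vertex) → List (List Vertex) → Set where
    []     : ∀ {u} → Extends c u [] []
    extend : ∀ {u a R R′ Rs Rs′} → a ≤ u → (∀ {v} → v ∈ˡ R′ → v ∈ˡ R ⊎ Fresh c a u v) →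
             Extends c a Rs Rs′ → Extends c u (R ∷ Rs) (R′ ∷ Rs′)

  cross-tails : ∀ {c u A B} → Cross (dots c) u A B → (ts : All (Tail (suc (κ c))) B) →
                Σ[ ts′ ∈ All (Tail (κ c)) A ] targets ts′ ≡ targets ts × Extends c u (rests ts) (rests ts′)
  cross-tails [] [] = [] , refl , []
  cross-tails (cons b<u (straight none) cr) (t ∷ ts) =
    let ts′ , e , ex = cross-tails cr ts
    in tail (target t) (rest t) (λ at → walk t (at-col-label (none ≤-refl) at)) ∷ ts′ ,
       cong (_ ∷_) e , extend (<⇒≤ b<u) inj₁ ex
  cross-tails (cons b<u (turn a≤b da db) cr) (t ∷ ts) =
    let ts′ , e , ex = cross-tails cr ts
        t′ , e′ , ex′ = turn-tail a≤b b<u da db t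
    in t′ ∷ ts′ , cong₂ _∷_ e′ e , extend (<⇒≤ (≤-<-trans a≤b b<u)) ex′ ex

  Late : ℕ → List Vertex → Set
  Late p = All (λ v → p ≤ potential v)

  fresh≢late : ∀ {c a u v} → Fresh c a u v → ¬ (suc (κ c) ≤ potential v)
  fresh≢late (r , d , refl , _) = <-irrefl refl

  late-weaken : ∀ {p} {Rs} → All (Late (suc p)) Rs → All (Late p) Rs
  late-weaken = All.map (All.map <⇒≤)

  all-extends : ∀ {P : Vertex → Set} {c u Rs Rs′} → Extends c u Rs Rs′ →
                (∀ {v} → Fresh c 0 u v → P v) → All (All P) Rs → All (All P) Rs′
  all-extends [] fr [] = []
  all-extends {P} {c} {u} (extend {R′ = R′} a≤u ex exs) fr (ps ∷ pss) =
    All.tabulate new ∷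
    all-extends exs (λ (r , d , e , s , t) → fr (r , d , e , s , <-≤-trans t a≤u)) pss
    where
    new : ∀ {v} → v ∈ˡ R′ → P v
    new m with ex m
    ... | inj₁ m′ = All.lookup ps m′
    ... | inj₂ f′ = fr (fresh-weaken z≤n f′)

  late-extends : ∀ {c u Rs Rs′} → Extends c u Rs Rs′ → All (Late (suc (κ c))) Rs → All (Late (κ c)) Rs′
  late-extends ex late = all-extends ex (λ { (_ , _ , refl , _) → ≤-refl }) (late-weaken late)

  disjoint-from : ∀ {vs : List Vertex} {Rs} → All (All (λ v → ¬ (v ∈ˡ vs))) Rs → All (Disjoint vs) Rs
  disjoint-from []         = []
  disjoint-from (ns ∷ nss) = (λ (p , q) → All.lookup ns q p) ∷ disjoint-from nss

  avoiding : ∀ {vs : List Vertex} {Rs} → All (Disjoint vs) Rs → All (All (λ v → ¬ (v ∈ˡ vs))) Rs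
  avoiding []       = []
  avoiding (d ∷ ds) = All.tabulate (λ q p → d (p , q)) ∷ avoiding ds

  separate : ∀ {c a R R′ Rs Rs′} →
             (∀ {v} → v ∈ˡ R′ → v ∈ˡ R ⊎ (v ≡ boundary (colLabel c) ⊎ ∃[ u ] Fresh c a u v)) →
             Extends c a Rs Rs′ → Late (suc (κ c)) R → All (Late (suc (κ c))) Rs →
             All (Disjoint R) Rs → All (Disjoint R′) Rs′
  separate {c} {a} {R} {R′} ex exs late lates dj =
    disjoint-from (all-extends exs fresh (combine lates (avoiding dj)))
    where
    fresh : ∀ {v} → Fresh c 0 a v → ¬ (v ∈ˡ R′)
    fresh fr@(r , d , refl , _ , lt) m with ex m
    ... | inj₁ m′ = fresh≢late fr (All.lookup late m′)
    ... | inj₂ (inj₂ (_ , r , d , refl , le , _)) = <⇒≱ lt le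
    old : ∀ {v} → suc (κ c) ≤ potential v → ¬ (v ∈ˡ R) → ¬ (v ∈ˡ R′)
    old le n m with ex m
    ... | inj₁ m′              = n m′
    ... | inj₂ (inj₁ refl)     = <-irrefl refl le
    ... | inj₂ (inj₂ (_ , fr)) = fresh≢late fr le
    combine : ∀ {Rs} → All (Late (suc (κ c))) Rs → All (All (λ v → ¬ (v ∈ˡ R))) Rs →
              All (All (λ v → ¬ (v ∈ˡ R′))) Rs
    combine []       []       = []
    combine (l ∷ ls) (n ∷ ns) = All.zipWith (λ (x , y) → old x y) (l , n) ∷ combine ls ns

  disjoint-extends : ∀ {c u Rs Rs′} → Extends c u Rs Rs′ → All (Late (suc (κ c))) Rs →
                     AllPairs Disjoint Rs → AllPairs Disjoint Rs′
  disjoint-extends [] _ _ = []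
  disjoint-extends {c} (extend {u} {a} {R} {R′} a≤u ex exs) (l ∷ ls) (d ∷ ds) =
    separate (λ m → widen (ex m)) exs l ls d ∷ disjoint-extends exs ls ds
    where
    widen : ∀ {v} → v ∈ˡ R ⊎ Fresh c a u v → v ∈ˡ R ⊎ (v ≡ boundary (colLabel c) ⊎ ∃[ u ] Fresh c a u v)
    widen (inj₁ m)  = inj₁ m
    widen (inj₂ fr) = inj₂ (inj₂ (u , fr))

  Missing : List Vertex → List (List Vertex) → Set
  Missing vs Rs = All (All (λ v → ¬ (v ∈ˡ vs))) Rs

  missing-extends : ∀ {c u vs Rs Rs′} → Extends c u Rs Rs′ → Late (suc (κ c)) vs →
                    Missing vs Rs → Missing vs Rs′
  missing-extends ex late = all-extends ex (λ fr m → fresh≢late fr (All.lookup late m))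

  -- The paths starting at p or later, and the remainders of those that started before.
  record Family (p : ℕ) (O : Stack) : Set where
    field
      tails    : All (Tail p) O
      paths    : List Path
      disjoint : AllPairs Disjoint (rests tails)
      apart    : NonTouching paths
      missing  : All (λ q → Missing (vertices q) (rests tails)) paths
      late     : All (Late p) (rests tails)
      latePath : All (λ q → Late p (vertices q)) paths
      started  : ∀ {r} → rowLabel r ∈ˡ map start paths → f (ρ r) ≡ false
      unused   : ∀ {r} → p ≤ ρ r → f (ρ r) ≡ false → rowLabel r ∈ˡ map start paths
      ended    : ∀ {c} → colLabel c ∈ˡ targets tails ⊎ colLabel c ∈ˡ map end paths → f (κ c) ≡ true
      reached  : ∀ {c} → p ≤ κ c → f (κ c) ≡ true →
                 colLabel c ∈ˡ targets tails ⊎ colLabel c ∈ˡ map end paths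
  open Family

  postpone : ∀ {r O} → All (Tail (suc (ρ r))) O → All (Tail (ρ r)) O
  postpone = All.map (λ t → tail (target t) (rest t) (λ at → walk t (at-row-label at)))

  postpone-rests : ∀ {r O} (ts : All (Tail (suc (ρ r))) O) → rests (postpone {r} ts) ≡ rests ts
  postpone-rests []       = refl
  postpone-rests (t ∷ ts) = cong (_ ∷_) (postpone-rests ts)

  postpone-targets : ∀ {r O} (ts : All (Tail (suc (ρ r))) O) → targets (postpone {r} ts) ≡ targets ts
  postpone-targets []       = refl
  postpone-targets (t ∷ ts) = cong (_ ∷_) (postpone-targets ts)

  stay-family : ∀ {r O} → f (ρ r) ≡ true → Family (suc (ρ r)) O → Family (ρ r) O
  stay-family {r} fr F = record
    { tails = ts ; paths = paths F
    ; disjoint = subst (AllPairs Disjoint) (sym eq) (disjoint F)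
    ; apart = apart F
    ; missing = All.map (λ {q} → subst (Missing (vertices q)) (sym eq)) (missing F)
    ; late = subst (All (Late (ρ r))) (sym eq) (late-weaken (late F))
    ; latePath = All.map (All.map <⇒≤) (latePath F)
    ; started = started F
    ; unused = unused′
    ; ended = λ m → ended F (subst (λ xs → _ ∈ˡ xs ⊎ _) eq′ m)
    ; reached = λ le fc → subst (λ xs → _ ∈ˡ xs ⊎ _) (sym eq′) (reached F (≤∧≢⇒< le ρ≢κ) fc)
    }
    where
    ts = postpone {r} (tails F)
    eq = postpone-rests {r} (tails F)
    eq′ = postpone-targets {r} (tails F)
    unused′ : ∀ {r′} → ρ r ≤ ρ r′ → f (ρ r′) ≡ false → rowLabel r′ ∈ˡ map start (paths F)
    unused′ le fr′ with m≤n⇒m<n∨m≡n le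
    ... | inj₁ lt = unused F lt fr′
    ... | inj₂ e  = contradiction (trans (cong f (sym e)) fr) (λ t → true≢false t fr′)

  push-family : ∀ {r O} → f (ρ r) ≡ false → Family (suc (ρ r)) (toℕ r ∷ O) → Family (ρ r) O
  push-family {r} {O} fr F with tails F | disjoint F | missing F | late F | ended F | reached F
  ... | t ∷ ts₀ | d ∷ ds | ms | l ∷ ls | en | re with walk t (at-start r)
  ... | es , ves = record
    { tails = ts ; paths = q ∷ paths F
    ; disjoint = subst (AllPairs Disjoint) (sym eq) ds
    ; apart = away ms (latePath F) ∷ apart F
    ; missing = subst (Missing (vertices q)) (sym eq)
                  (subst (λ vs → Missing vs (rests ts₀)) (sym ves) (both ls (avoiding d)))
              ∷ All.map (λ { {q} (_ ∷ m) → subst (Missing (vertices q)) (sym eq) m }) ms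
    ; late = subst (All (Late (ρ r))) (sym eq) (late-weaken ls)
    ; latePath = subst (Late (ρ r)) (sym ves) (≤-refl ∷ All.map <⇒≤ l) ∷ All.map (All.map <⇒≤) (latePath F)
    ; started = started′
    ; unused = unused′
    ; ended = λ { (inj₁ m) → en (inj₁ (there (subst (_ ∈ˡ_) eq′ m)))
                ; (inj₂ (here e)) → en (inj₁ (here e))
                ; (inj₂ (there m)) → en (inj₂ m) }
    ; reached = λ le fc → reached′ (re (≤∧≢⇒< le ρ≢κ) fc)
    }
    where
    q : Path
    q = record { start = rowLabel r ; end = target t ; edges = es }
    ts = postpone {r} ts₀
    eq = postpone-rests {r} ts₀
    eq′ = postpone-targets {r} ts₀
    away : ∀ {qs Rs} → All (λ q → Missing (vertices q) (rest t ∷ Rs)) qs →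
           All (λ q → Late (suc (ρ r)) (vertices q)) qs →
           All (λ q′ → Disjoint (vertices q) (vertices q′)) qs
    away [] [] = []
    away {q′ ∷ _} ((m ∷ _) ∷ ms) (lp ∷ lps) = (λ (x , y) → meet (subst (_ ∈ˡ_) ves x) y) ∷ away ms lps
      where
      meet : ∀ {v} → v ∈ˡ boundary (rowLabel r) ∷ rest t → ¬ (v ∈ˡ vertices q′)
      meet (here refl) y = <-irrefl refl (All.lookup lp y)
      meet (there x)   y = All.lookup m x y
    both : ∀ {Rs} → All (Late (suc (ρ r))) Rs → Missing (rest t) Rs →
           Missing (boundary (rowLabel r) ∷ rest t) Rs
    both []       []       = []
    both (l ∷ ls) (n ∷ ns) =
      All.zipWith (λ { (x , y) (here refl) → <-irrefl refl x ; (x , y) (there m) → y m }) (l , n) ∷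
      both ls ns
    started′ : ∀ {r′} → rowLabel r′ ∈ˡ map start (q ∷ paths F) → f (ρ r′) ≡ false
    started′ (here e)  = trans (cong (f ∘ toℕ) e) fr
    started′ (there m) = started F m
    unused′ : ∀ {r′} → ρ r ≤ ρ r′ → f (ρ r′) ≡ false → rowLabel r′ ∈ˡ map start (q ∷ paths F)
    unused′ le fr′ with m≤n⇒m<n∨m≡n le
    ... | inj₁ lt = there (unused F lt fr′)
    ... | inj₂ e  = here (toℕ-injective (sym e))
    reached′ : ∀ {x} → x ∈ˡ (target t ∷ targets ts₀) ⊎ x ∈ˡ map end (paths F) →
               x ∈ˡ targets ts ⊎ x ∈ˡ map end (q ∷ paths F)
    reached′ (inj₁ (here e))  = inj₂ (here e)
    reached′ (inj₁ (there m)) = inj₁ (subst (_ ∈ˡ_) (sym eq′) m)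
    reached′ (inj₂ m)         = inj₂ (there m)

  unused-col : ∀ {c O} (F : Family (suc (κ c)) O) {r} → κ c ≤ ρ r → f (ρ r) ≡ false →
               rowLabel r ∈ˡ map start (paths F)
  unused-col F le = unused F (≤∧≢⇒< le (ρ≢κ ∘ sym))

  pass-family : ∀ {c u O O′} → f (κ c) ≡ false → Cross (dots c) u O O′ →
                Family (suc (κ c)) O′ → Family (κ c) O
  pass-family {c} fc cr F with cross-tails cr (tails F)
  ... | ts , eq , ex = record
    { tails = ts ; paths = paths F
    ; disjoint = disjoint-extends ex (late F) (disjoint F)
    ; apart = apart F
    ; missing = All.zipWith (λ (l , m) → missing-extends ex l m) (latePath F , missing F)
    ; late = late-extends ex (late F)
    ; latePath = All.map (All.map <⇒≤) (latePath F)
    ; started = started F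
    ; unused = unused-col F
    ; ended = λ m → ended F (subst (λ xs → _ ∈ˡ xs ⊎ _) eq m)
    ; reached = λ le fc′ → subst (λ xs → _ ∈ˡ xs ⊎ _) (sym eq) (reached F (later le fc′) fc′)
    }
    where
    later : ∀ {c′} → κ c ≤ κ c′ → f (κ c′) ≡ true → suc (κ c) ≤ κ c′
    later le fc′ = ≤∧≢⇒< le (λ e → true≢false (trans (cong f e) fc′) fc)

  exit-family : ∀ {c a O O′} → f (κ c) ≡ true → T (dots c a) → Cross (dots c) a O O′ →
                Family (suc (κ c)) O′ → Family (κ c) (a ∷ O)
  exit-family {c} {a} fc da cr F with cross-tails cr (tails F) | exit-tail da
  ... | ts , eq , ex | t , e , fresh = record
    { tails = t ∷ ts ; paths = paths F
    ; disjoint = separate {R = []} (λ m → widen (fresh m)) ex [] (late F) (All.tabulate (λ _ ()))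
               ∷ disjoint-extends ex (late F) (disjoint F)
    ; apart = apart F
    ; missing = All.zipWith (λ (l , m) → All.tabulate (λ i j → unmet (fresh i) (All.lookup l j)) ∷
                                         missing-extends ex l m)
                            (latePath F , missing F)
    ; late = All.tabulate (λ m → reach (fresh m)) ∷ late-extends ex (late F)
    ; latePath = All.map (All.map <⇒≤) (latePath F)
    ; started = started F
    ; unused = unused-col F
    ; ended = ended′
    ; reached = reached′
    }
    where
    widen : ∀ {v} → v ≡ boundary (colLabel c) ⊎ Fresh c a k v →
            v ∈ˡ [] ⊎ (v ≡ boundary (colLabel c) ⊎ ∃[ u ] Fresh c a u v)
    widen (inj₁ e)  = inj₂ (inj₁ e)
    widen (inj₂ fr) = inj₂ (inj₂ (k , fr))
    unmet : ∀ {v} → v ≡ boundary (colLabel c) ⊎ Fresh c a k v → ¬ (suc (κ c) ≤ potential v)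
    unmet (inj₁ refl) le = <-irrefl refl le
    unmet (inj₂ fr)      = fresh≢late fr
    reach : ∀ {v} → v ≡ boundary (colLabel c) ⊎ Fresh c a k v → κ c ≤ potential v
    reach (inj₁ refl)               = ≤-refl
    reach (inj₂ (_ , _ , refl , _)) = ≤-refl
    ended′ : ∀ {c′} → colLabel c′ ∈ˡ (target t ∷ targets ts) ⊎ colLabel c′ ∈ˡ map end (paths F) →
             f (κ c′) ≡ true
    ended′ (inj₁ (here e′)) = trans (cong (f ∘ toℕ) (trans e′ e)) fc
    ended′ (inj₁ (there m)) = ended F (inj₁ (subst (_ ∈ˡ_) eq m))
    ended′ (inj₂ m)         = ended F (inj₂ m)
    reached′ : ∀ {c′} → κ c ≤ κ c′ → f (κ c′) ≡ true →
               colLabel c′ ∈ˡ (target t ∷ targets ts) ⊎ colLabel c′ ∈ˡ map end (paths F)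
    reached′ le fc′ with m≤n⇒m<n∨m≡n le
    ... | inj₂ e′ = inj₁ (here (trans (toℕ-injective (sym e′)) (sym e)))
    ... | inj₁ lt with reached F lt fc′
    ...   | inj₁ m = inj₁ (there (subst (_ ∈ˡ_) (sym eq) m))
    ...   | inj₂ m = inj₂ m

  family : ∀ d {p O} → p + d ≡ n → Rest (upward step f p d) O → Family p O
  family zero {p} eq [] = record
    { tails = [] ; paths = [] ; disjoint = [] ; apart = [] ; missing = [] ; late = [] ; latePath = []
    ; started = λ () ; unused = λ {r} le _ → contradiction (toℕ<n (rowLabel r)) (≤⇒≯ (≤-trans n≤p le))
    ; ended = λ { (inj₁ ()) ; (inj₂ ()) }
    ; reached = λ {c} le _ → contradiction (toℕ<n (colLabel c)) (≤⇒≯ (≤-trans n≤p le)) }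
    where
    n≤p : n ≤ p
    n≤p = ≤-reflexive (trans (sym eq) (+-identityʳ p))
  family (suc d) {p} {O} eq R with kind (<-≤-trans (m<m+n p (s≤s z≤n)) (≤-reflexive eq))
  ... | row r refl sp = by-row (f p) refl (subst (λ s → Rest ((s , f p) ∷ upward step f (suc p) d) O) sp R)
    where
    by-row : ∀ b → f p ≡ b → Rest ((row (toℕ r) , b) ∷ upward step f (suc p) d) O → Family p O
    by-row true  fp (stay _ R′) = stay-family fp (family d (trans (sym (+-suc p d)) eq) R′)
    by-row false fp (push _ R′) = push-family fp (family d (trans (sym (+-suc p d)) eq) R′)
  ... | col c refl sp = by-col (f p) refl (subst (λ s → Rest ((s , f p) ∷ upward step f (suc p) d) O) sp R)
    where
    by-col : ∀ {O} b → f p ≡ b → Rest ((col (dots c) , b) ∷ upward step f (suc p) d) O → Family p O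
    by-col false fp (pass cr R′)    = pass-family fp cr (family d (trans (sym (+-suc p d)) eq) R′)
    by-col true  fp (exit da cr R′) = exit-family fp da cr (family d (trans (sym (+-suc p d)) eq) R′)

  family-of : Rest (upward step f 0 n) [] → ∃[ ps ] NonTouching ps × Describes f ps
  family-of R with family n refl R
  ... | record { tails = [] ; paths = ps ; apart = nt ; started = st ; unused = un ; ended = en
               ; reached = re } =
    ps , nt , record { started = st ; unused = un z≤n ; ended = en ∘ inj₂
                     ; reached = λ fc → finish (re z≤n fc) }
    where
    finish : ∀ {x : Fin n} → x ∈ˡ [] ⊎ x ∈ˡ map end ps → x ∈ˡ map end ps
    finish (inj₂ m) = m

-- Subsets as predicates on positions

x∈p─q⇒x∉q : ∀ {n} {x : Fin n} p q → x ∈ p ─ q → x ∉ q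
x∈p─q⇒x∉q (s ∷ p) (inside ∷ q) () here
x∈p─q⇒x∉q (s ∷ p) (t ∷ q) (there m) (there m′) = x∈p─q⇒x∉q p q m m′

subset : ∀ n → (ℕ → Bool) → Subset n
subset n f = Vec.tabulate (f ∘ toℕ)

∈-subset⁺ : ∀ {n} f {x : Fin n} → f (toℕ x) ≡ true → x ∈ subset n f
∈-subset⁺ f {x} fx = lookup⇒[]= x _ (trans (lookup∘tabulate (f ∘ toℕ) x) fx)

∈-subset⁻ : ∀ {n} f {x : Fin n} → x ∈ subset n f → f (toℕ x) ≡ true
∈-subset⁻ f {x} m = trans (sym (lookup∘tabulate (f ∘ toℕ) x)) ([]=⇒lookup m)

∉-subset : ∀ {n} f {x : Fin n} → x ∉ subset n f → f (toℕ x) ≡ false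
∉-subset f {x} n with f (toℕ x) in eq
... | true  = contradiction (∈-subset⁺ f eq) n
... | false = refl

bits : ∀ {n} → Subset n → ℕ → Bool
bits []      _       = false
bits (b ∷ B) zero    = b
bits (b ∷ B) (suc i) = bits B i

bits-lookup : ∀ {n} (B : Subset n) x → bits B (toℕ x) ≡ Vec.lookup B x
bits-lookup (b ∷ B) zero    = refl
bits-lookup (b ∷ B) (suc x) = bits-lookup B x

subset-bits : ∀ {n} (B : Subset n) → subset n (bits B) ≡ B
subset-bits B = trans (tabulate-cong (bits-lookup B)) (tabulate∘lookup B)

bits-subset : ∀ n f {i} → i < n → bits (subset n f) i ≡ f i
bits-subset (suc n) f {zero}  _         = refl
bits-subset (suc n) f {suc i} (s≤s i<n) = bits-subset n (f ∘ suc) i<n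

subset-cong : ∀ {n f g} → (∀ {x} → x < n → f x ≡ g x) → subset n f ≡ subset n g
subset-cong eq = tabulate-cong (λ x → eq (toℕ<n x))

subset-swap : ∀ {n} f (x y : Fin n) → subset n (swap f (toℕ x) (toℕ y)) ≡ (subset n f - x) ∪ ⁅ y ⁆
subset-swap {n} f x y = ⊆-antisym to from
  where
  g : ℕ → Bool
  g = swap f (toℕ x) (toℕ y)
  to : ∀ {z} → z ∈ subset n (swap f (toℕ x) (toℕ y)) → z ∈ (subset n f - x) ∪ ⁅ y ⁆
  to {z} m with swap-true f (toℕ x) (toℕ y) (toℕ z) (∈-subset⁻ g m)
  ... | inj₁ eq rewrite toℕ-injective eq = x∈p∪q⁺ (inj₂ (x∈⁅x⁆ y))
  ... | inj₂ (z≢x , fz) = x∈p∪q⁺ (inj₁ (x∈p∧x≢y⇒x∈p-y (∈-subset⁺ f fz) (z≢x ∘ cong toℕ)))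
  from : ∀ {z} → z ∈ (subset n f - x) ∪ ⁅ y ⁆ → z ∈ subset n (swap f (toℕ x) (toℕ y))
  from {z} m with x∈p∪q⁻ (subset n f - x) ⁅ y ⁆ m
  ... | inj₂ q rewrite x∈⁅y⁆⇒x≡y y q = ∈-subset⁺ g (swap-in f (toℕ x) (toℕ y))
  ... | inj₁ q with z Fin.≟ y
  ...   | yes refl = ∈-subset⁺ g (swap-in f (toℕ x) (toℕ y))
  ...   | no z≢y = ∈-subset⁺ g (trans (swap-other f
      (λ e → x∈p─q⇒x∉q (subset n f) ⁅ x ⁆ q (subst (λ w → z ∈ ⁅ w ⁆) (toℕ-injective e) (x∈⁅x⁆ z)))
      (z≢y ∘ toℕ-injective))
    (∈-subset⁻ f (p─q⊆p (subset n f) ⁅ x ⁆ q)))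

-- The words of subsets

module _ (S : ℕ → Step) where
  open Words S

  word-upward : ∀ f p d → upward S f p d ʳ++ word f p ≡ word f (d + p)
  word-upward f p zero    = refl
  word-upward f p (suc d) = trans (word-upward f (suc p) d) (cong (word f) (+-suc d p))

  word-bits : ∀ {f} i W → map proj₁ W ≡ map proj₁ (word f i) → ∃[ g ] W ≡ word g i
  word-bits {f} zero    []            _  = f , refl
  word-bits {f} (suc i) ((s , b) ∷ W) eq with word-bits {f} i W (∷-injectiveʳ eq) | ∷-injective eq
  ... | g , refl | refl , _ = g [ i ≔ b ] , cong₂ (λ c K → (S i , c) ∷ K)
    (sym (update-same g i b)) (word-cong i (λ x<i → sym (update-other g b (<⇒≢ x<i))))

labels-ʳ++ : ∀ (C : Word) {K K′} → map proj₁ K ≡ map proj₁ K′ → map proj₁ (C ʳ++ K) ≡ map proj₁ (C ʳ++ K′)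
labels-ʳ++ []      eq = eq
labels-ʳ++ (l ∷ C) eq = labels-ʳ++ C (cong (proj₁ l ∷_) eq)

labels-ʳ++⁻ : ∀ (C : Word) {K K′} → map proj₁ (C ʳ++ K) ≡ map proj₁ (C ʳ++ K′) → map proj₁ K ≡ map proj₁ K′
labels-ʳ++⁻ []      eq = eq
labels-ʳ++⁻ (l ∷ C) eq = ∷-injectiveʳ (labels-ʳ++⁻ C eq)

labels-dropPaths : ∀ K fs → map proj₁ (dropPaths K fs) ≡ map proj₁ K
labels-dropPaths []                    fs       = refl
labels-dropPaths ((row r , true) ∷ K)  fs       = cong (_ ∷_) (labels-dropPaths K fs)
labels-dropPaths ((row r , false) ∷ K) []       = cong (_ ∷_) (labels-dropPaths K [])
labels-dropPaths ((row r , false) ∷ K) (f ∷ fs) = cong (_ ∷_) (labels-dropPaths K fs)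
labels-dropPaths ((col D , false) ∷ K) fs       = cong (_ ∷_) (labels-dropPaths K fs)
labels-dropPaths ((col D , true) ∷ K)  fs       = cong (_ ∷_) (labels-dropPaths K (false ∷ fs))

relabelled? : ∀ (K : Word) {P : Word → Set} → (∀ (K′ : Word) → map proj₁ K′ ≡ map proj₁ K → Dec (P K′)) →
              Dec (Σ[ K′ ∈ Word ] map proj₁ K′ ≡ map proj₁ K × P K′)
relabelled? [] P? with P? [] refl
... | yes p = yes ([] , refl , p)
... | no ¬p = no (λ { ([] , _ , p) → ¬p p })
relabelled? ((s , b) ∷ K) {P} P?
  with relabelled? K (λ K′ eq → P? ((s , false) ∷ K′) (cong (s ∷_) eq))
     | relabelled? K (λ K′ eq → P? ((s , true) ∷ K′) (cong (s ∷_) eq))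
... | yes (K′ , eq , p) | _ = yes (_ , cong (s ∷_) eq , p)
... | no _ | yes (K′ , eq , p) = yes (_ , cong (s ∷_) eq , p)
... | no ¬p | no ¬q = no neither
  where
  neither : ¬ (Σ[ K′ ∈ Word ] map proj₁ K′ ≡ s ∷ map proj₁ K × P K′)
  neither ((_ , false) ∷ K′ , eq , p) with refl , eq′ ← ∷-injective eq = ¬p (K′ , eq′ , p)
  neither ((_ , true)  ∷ K′ , eq , p) with refl , eq′ ← ∷-injective eq = ¬q (K′ , eq′ , p)

module Positroid {n : ℕ} (L : LeDiagram n) where
  open LeDiagram L
  open LeGraph L
  open Labels L
  open Graph L
  open Words step

  ∈-B₀⁺ : ∀ r → rowLabel r ∈ B₀
  ∈-B₀⁺ r = ∈-setOf⁺ (∈-map⁺ rowLabel (∈-tabulate⁺ r))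

  ∈-B₀⁻ : ∀ {x} → x ∈ B₀ → ∃[ r ] x ≡ rowLabel r
  ∈-B₀⁻ m with ∈-map⁻ rowLabel (∈-setOf⁻ (map rowLabel (allFin k)) m)
  ... | r , _ , eq = r , eq

  ends-col : ∀ ps {r} → ¬ (rowLabel r ∈ˡ map end ps)
  ends-col ps m with ∈-map⁻ end m
  ... | q , _ , eq with end-col (edges q) refl
  ...   | c , eq′ = ρ≢κ (cong toℕ (trans eq eq′))

  describes : ∀ f ps → subset n f ≡ represented ps → Describes f ps
  describes f ps eq = record { started = st ; unused = un ; ended = en ; reached = re }
    where
    into : ∀ {x} → x ∈ subset n f → x ∈ represented ps
    into = subst (_ ∈_) eq
    back : ∀ {x} → x ∈ represented ps → x ∈ subset n f
    back = subst (_ ∈_) (sym eq)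
    st : ∀ {r} → rowLabel r ∈ˡ map start ps → f (ρ r) ≡ false
    st {r} m = ∉-subset f (λ i → no-way (x∈p∪q⁻ (B₀ ─ setOf (map start ps)) _ (into i)))
      where
      no-way : ¬ (rowLabel r ∈ B₀ ─ setOf (map start ps) ⊎ rowLabel r ∈ setOf (map end ps))
      no-way (inj₁ i) = x∈p─q⇒x∉q B₀ _ i (∈-setOf⁺ m)
      no-way (inj₂ i) = ends-col ps (∈-setOf⁻ _ i)
    un : ∀ {r} → f (ρ r) ≡ false → rowLabel r ∈ˡ map start ps
    un {r} fr with rowLabel r ∈? setOf (map start ps)
    ... | yes i = ∈-setOf⁻ _ i
    ... | no ∉s = contradiction fr (true≢false
      (∈-subset⁻ f (back (x∈p∪q⁺ (inj₁ (x∈p∧x∉q⇒x∈p─q (∈-B₀⁺ r) ∉s))))))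
    en : ∀ {c} → colLabel c ∈ˡ map end ps → f (κ c) ≡ true
    en m = ∈-subset⁻ f (back (x∈p∪q⁺ (inj₂ (∈-setOf⁺ m))))
    re : ∀ {c} → f (κ c) ≡ true → colLabel c ∈ˡ map end ps
    re fc with x∈p∪q⁻ (B₀ ─ setOf (map start ps)) _ (into (∈-subset⁺ f fc))
    ... | inj₂ i = ∈-setOf⁻ _ i
    ... | inj₁ i with ∈-B₀⁻ (p─q⊆p B₀ _ i)
    ...   | r , eq′ = contradiction (cong toℕ (sym eq′)) ρ≢κ

  described : ∀ f ps → Describes f ps → subset n f ≡ represented ps
  described f ps D = ⊆-antisym to from
    where
    open Describes D
    to : ∀ {x} → x ∈ subset n f → x ∈ represented ps
    to {x} i with label-surjective x
    ... | inj₂ c , refl = x∈p∪q⁺ (inj₂ (∈-setOf⁺ (reached (∈-subset⁻ f i))))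
    ... | inj₁ r , refl = x∈p∪q⁺ (inj₁ (x∈p∧x∉q⇒x∈p─q (∈-B₀⁺ r)
      (λ m → true≢false (∈-subset⁻ f i) (started (∈-setOf⁻ _ m)))))
    from : ∀ {x} → x ∈ represented ps → x ∈ subset n f
    from {x} i with x∈p∪q⁻ (B₀ ─ setOf (map start ps)) _ i | label-surjective x
    ... | inj₁ m | inj₂ c , refl with ∈-B₀⁻ (p─q⊆p B₀ _ m)
    ...   | r , eq = contradiction (cong toℕ (sym eq)) ρ≢κ
    from {x} i | inj₂ m | inj₁ r , refl = contradiction (∈-setOf⁻ _ m) (ends-col ps)
    from {x} i | inj₂ m | inj₂ c , refl = ∈-subset⁺ f (ended (∈-setOf⁻ _ m))
    from {x} i | inj₁ m | inj₁ r , refl with f (ρ r) in fr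
    ... | true  = ∈-subset⁺ f fr
    ... | false = contradiction (∈-setOf⁺ (unused fr)) (x∈p─q⇒x∉q B₀ _ m)

  word-rest : ∀ f → upward step f 0 n ʳ++ [] ≡ word f n
  word-rest f = trans (word-upward step f 0 n) (cong (word f) (+-identityʳ n))

  represented⇒run : ∀ f → Represented (subset n f) → Run (word f n) []
  represented⇒run f (ps , nt , eq) = subst (λ W → Run W []) (word-rest f)
    (join [] (FromPaths.complete-run f ps nt (describes f ps eq)))

  run⇒represented : ∀ f → Run (word f n) [] → Represented (subset n f)
  run⇒represented f R with split (upward step f 0 n) (subst (λ W → Run W []) (sym (word-rest f)) R)
  ... | [] , [] , S with FromRun.family-of L f S
  ...   | ps , nt , D = ps , nt , described f ps D

  𝓑 : Word → Set
  𝓑 W = map proj₁ W ≡ map proj₁ (word (λ _ → false) n) × Run W []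

  module _ (M : Matroid n) (pos : ∀ B → Matroid.Basis M B ⇔ Represented B) where
    open Matroid M
    open Equivalence

    basis⇒𝓑 : ∀ f → Basis (subset n f) → 𝓑 (word f n)
    basis⇒𝓑 f b = word-labels f _ n , represented⇒run f (to (pos _) b)

    𝓑⇒basis : ∀ f → 𝓑 (word f n) → Basis (subset n f)
    𝓑⇒basis f (_ , R) = from (pos _) (run⇒represented f R)

    𝓑-word? : ∀ f → Dec (𝓑 (word f n))
    𝓑-word? f = map′ (basis⇒𝓑 f) (𝓑⇒basis f) (basis? (subset n f))

    𝓑? : ∀ W → map proj₁ W ≡ map proj₁ (word (λ _ → false) n) → Dec (𝓑 W)
    𝓑? W eq with word-bits step n W eq
    ... | f , refl = 𝓑-word? f

    linked : IsLinked 𝓑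
    linked = record
      { drop-col = λ C {D} {K} (eq , R) →
          trans (labels-ʳ++ C (cong (col D ∷_) (labels-dropPaths K (true ∷ [])))) eq , drop-column C R
      ; drop-row = λ C {r} {K} (eq , R) (_ , R′) →
          trans (labels-ʳ++ C (cong (row r ∷_) (labels-dropPaths K (true ∷ [])))) eq , reroute C R R′
      ; balanced = λ (_ , R) → run-height R
      ; avoid?   = avoid
      }
      where
      avoid : ∀ C {r b K} → 𝓑 (C ʳ++ ((row r , b) ∷ K)) → Dec (∃[ K′ ] 𝓑 (C ʳ++ ((row r , false) ∷ K′)))
      avoid C {r} {b} {K} (eq , _) = map′ (λ (K′ , _ , p) → K′ , p)
        (λ (K′ , p) → K′ , ∷-injectiveʳ (labels-ʳ++⁻ C (trans (proj₁ p) (sym eq))) , p)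
        (relabelled? K (λ K′ eq′ → 𝓑? _ (trans (labels-ʳ++ C (cong (row r ∷_) eq′)) eq)))

    open Purity linked step n

    exchange′ : Exchange
    exchange′ {a} {b} {x} ba bb x<n ax bx
      with exchange (𝓑⇒basis a ba) (𝓑⇒basis b bb)
             (∈-subset⁺ a {fromℕ< x<n} (trans (cong a (toℕ-fromℕ< x<n)) ax))
             (λ m → true≢false (∈-subset⁻ b m) (trans (cong b (toℕ-fromℕ< x<n)) bx))
    ... | y , y∈b , y∉a , b′ = toℕ y , toℕ<n y , ∈-subset⁻ b y∈b , ∉-subset a y∉a ,
      subst (λ x → Basisᶠ (swap a x (toℕ y))) (toℕ-fromℕ< x<n)
        (basis⇒𝓑 _ (subst Basis (sym (subset-swap a (fromℕ< x<n) y)) b′))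

does⇒ : ∀ {P : Set} (p? : Dec P) → does p? ≡ true → P
does⇒ (yes p) _ = p

unique-map : ∀ {A B : Set} {g : A → B} {xs} → (∀ {x y} → x ∈ˡ xs → y ∈ˡ xs → g x ≡ g y → x ≡ y) →
             Unique xs → Unique (map g xs)
unique-map inj []         = []
unique-map inj (ns ∷ us) =
  All.map⁺ (All.tabulate (λ m e → All.lookup ns m (inj (here refl) (there m) e))) ∷
  unique-map (λ p q → inj (there p) (there q)) us

allSubsets-complete : ∀ {n} (B : Subset n) → B ∈ˡ allSubsets n
allSubsets-complete []            = here refl
allSubsets-complete (outside ∷ B) = ∈-++⁺ˡ (∈-map⁺ (outside ∷_) (allSubsets-complete B))
allSubsets-complete (inside ∷ B)  =
  ∈-++⁺ʳ (map (outside ∷_) (allSubsets _)) (∈-map⁺ (inside ∷_) (allSubsets-complete B))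

allSubsets-unique : ∀ n → Unique (allSubsets n)
allSubsets-unique zero    = [] ∷ []
allSubsets-unique (suc n) = unique-++⁺
  (unique-map⁺ ∷-injectiveʳᵛ (allSubsets-unique n))
  (unique-map⁺ ∷-injectiveʳᵛ (allSubsets-unique n))
  (λ { (p , q) → clash (∈-map⁻ (outside ∷_) p) (∈-map⁻ (inside ∷_) q) })
  where
  clash : ∀ {v : Subset (suc n)} → ∃[ x ] x ∈ˡ allSubsets n × v ≡ outside ∷ x →
          ¬ (∃[ y ] y ∈ˡ allSubsets n × v ≡ inside ∷ y)
  clash (_ , _ , refl) (_ , _ , ())

count-up : ∀ q i → count q (suc i) ≡ bit (q 0) + count (q ∘ suc) i
count-up q zero    = refl
count-up q (suc i) = trans (cong (bit (q (suc i)) +_) (count-up q i))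
                             (x∙yz≈y∙xz (bit (q (suc i))) (bit (q 0)) _)

count-filter : ∀ {A : Set} {P : A → Set} (P? : Decidable P) {m} (g : Fin m → A) q →
               (∀ x → does (P? (g x)) ≡ q (toℕ x)) →
               length (filter P? (tabulate g)) ≡ count q m
count-filter P? {zero}  g q eq = refl
count-filter P? {suc m} g q eq with P? (g zero) | eq zero
... | yes _ | e = trans (cong suc (count-filter P? (g ∘ suc) (q ∘ suc) (eq ∘ suc)))
                        (sym (trans (count-up q m) (cong (λ b → bit b + count (q ∘ suc) m) (sym e))))
... | no _  | e = trans (count-filter P? (g ∘ suc) (q ∘ suc) (eq ∘ suc))
                        (sym (trans (count-up q m) (cong (λ b → bit b + count (q ∘ suc) m) (sym e))))

count-size : ∀ {n} (B : Subset n) → count (bits B) n ≡ ∣ B ∣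
count-size []                = refl
count-size {suc n} (outside ∷ B) = trans (count-up (bits (outside ∷ B)) n) (count-size B)
count-size {suc n} (inside ∷ B)  = trans (count-up (bits (inside ∷ B)) n) (cong suc (count-size B))

count-≤ : ∀ {p q} i → (∀ {x} → x < i → p x ≡ true → q x ≡ true) → count p i ≤ count q i
count-≤ zero    imp = z≤n
count-≤ {p} {q} (suc i) imp = +-mono-≤ (bit-≤ (p i) (q i) (imp ≤-refl)) (count-≤ i (imp ∘ m<n⇒m<1+n))
  where
  bit-≤ : ∀ a b → (a ≡ true → b ≡ true) → bit a ≤ bit b
  bit-≤ false b imp = z≤n
  bit-≤ true  b imp rewrite imp refl = ≤-refl

filter-map-length : ∀ {A B : Set} (g : A → B) (d : B → ℕ) (p : A → ℕ) i xs →
  (∀ {x} → x ∈ˡ xs → d (g x) ≡ p x) →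
  length (filter (λ y → d y ≟ i) (map g xs)) ≡ length (filter (λ x → p x ≟ i) xs)
filter-map-length g d p i []       eq = refl
filter-map-length g d p i (x ∷ xs) eq rewrite eq (here refl) with p x ≡ᵇ i
... | true  = cong suc (filter-map-length g d p i xs (eq ∘ there))
... | false = filter-map-length g d p i xs (eq ∘ there)

filter-empty : ∀ {A : Set} (d : A → ℕ) i xs → (∀ {x} → x ∈ˡ xs → d x < i) →
               length (filter (λ x → d x ≟ i) xs) ≡ 0
filter-empty d i xs lt =
  cong length (filter-none (λ x → d x ≟ i) (All.tabulate (λ m e → <-irrefl e (lt m))))

≤-maximum : ∀ {A : Set} (d : A → ℕ) {x xs} → x ∈ˡ xs → d x ≤ foldr _⊔_ 0 (map d xs)
≤-maximum d {xs = y ∷ ys} (here refl) = m≤m⊔n (d y) _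
≤-maximum d {xs = y ∷ ys} (there m)   = ≤-trans (≤-maximum d m) (m≤n⊔m (d y) _)

maximum-≤ : ∀ {A : Set} (d : A → ℕ) {b} xs → (∀ {x} → x ∈ˡ xs → d x ≤ b) → foldr _⊔_ 0 (map d xs) ≤ b
maximum-≤ d []       le = z≤n
maximum-≤ d (x ∷ xs) le = ⊔-lub (le (here refl)) (maximum-≤ d xs (le ∘ there))

applyUpTo-padded : ∀ (g h : ℕ → ℕ) a b → a ≤ b → (∀ i → g i ≡ h i) → (∀ i → a ≤ i → h i ≡ 0) →
                   applyUpTo g b ≡ applyUpTo h a ++ replicate (b ∸ a) 0
applyUpTo-padded g h zero zero    le eq z = refl
applyUpTo-padded g h zero (suc b) le eq z =
  cong₂ _∷_ (trans (eq 0) (z 0 z≤n))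
            (applyUpTo-padded (g ∘ suc) (h ∘ suc) 0 b z≤n (eq ∘ suc) (λ i _ → z (suc i) z≤n))
applyUpTo-padded g h (suc a) (suc b) (s≤s le) eq z =
  cong₂ _∷_ (eq 0)
            (applyUpTo-padded (g ∘ suc) (h ∘ suc) a b le (eq ∘ suc) (λ i le → z (suc i) (s≤s le)))

module Ideal {n : ℕ} (L : LeDiagram n) (M : Matroid n)
             (pos : ∀ B → Matroid.Basis M B ⇔ LeGraph.Represented L B) where
  open Labels L
  open Positroid L
  open Matroid M
  open Words step
  private
    linked′ : IsLinked 𝓑
    linked′ = linked M pos
    exch = exchange′ M pos
    𝓑ᶠ? = 𝓑-word? M pos
  open Codes linked′
  open Purity linked′ step n
  open Counting linked′ step n

  basis-bits : ∀ {B} → Basis B → Basisᶠ (bits B)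
  basis-bits {B} b = basis⇒𝓑 M pos (bits B) (subst Basis (sym (subset-bits B)) b)

  monomial : Subset n → Monomial n
  monomial B with basis? B
  ... | yes b = proj₁ (code-of (basis-bits b))
  ... | no _  = Vec.replicate n 0

  monomial-code : ∀ {B} → Basis B → Code [] (monomial B) [] (word (bits B) n)
  monomial-code {B} b with basis? B
  ... | yes b′ = proj₂ (code-of (basis-bits b′))
  ... | no ¬b  = contradiction b ¬b

  bases : List (Subset n)
  bases = filter basis? (allSubsets n)

  ∈-bases⁺ : ∀ {B} → Basis B → B ∈ˡ bases
  ∈-bases⁺ b = ∈-filter⁺ basis? (allSubsets-complete _) b

  ∈-bases⁻ : ∀ {B} → B ∈ˡ bases → Basis B
  ∈-bases⁻ m = proj₂ (∈-filter⁻ basis? {xs = allSubsets n} m)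

  code⇒monomial : ∀ {e K} → Code {n} [] e [] K → e ∈ˡ map monomial bases
  code⇒monomial {e} c with word-bits step n _ (proj₁ (code-basis c))
  ... | f , refl = subst (_∈ˡ map monomial bases) (sym eq) (∈-map⁺ monomial (∈-bases⁺ basis))
    where
    basis : Basis (subset n f)
    basis = 𝓑⇒basis M pos f (code-basis c)
    eq : e ≡ monomial (subset n f)
    eq = proj₁ (code-functional c
      (subst (Code [] _ []) (word-cong n (bits-subset n f)) (monomial-code basis)))

  monomial-injective : ∀ {A B} → A ∈ˡ bases → B ∈ˡ bases → monomial A ≡ monomial B → A ≡ B
  monomial-injective {A} {B} a b eq = trans (sym (subset-bits A)) (trans (subset-cong
    (code-injectiveᶠ (subst (λ e → Code [] e [] (word (bits A) n)) eq (monomial-code (∈-bases⁻ a)))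
                     (monomial-code (∈-bases⁻ b)))) (subset-bits B))

  ideal : OrderIdeal n
  ideal = record
    { monomials = map monomial bases
    ; unique    = unique-map monomial-injective (unique-filter⁺ basis? (allSubsets-unique n))
    ; nonempty  = nonempty′
    ; closed    = closed
    }
    where
    nonempty′ : map monomial bases ≢ []
    nonempty′ eq with subst (monomial (proj₁ nonempty) ∈ˡ_) eq (∈-map⁺ monomial (∈-bases⁺ (proj₂ nonempty)))
    ... | ()
    closed : ∀ {e e′} → e ∈ˡ map monomial bases → e′ Divides e → e′ ∈ˡ map monomial bases
    closed m p with ∈-map⁻ monomial m
    ... | B , i , refl = code⇒monomial (proj₂ (divisor-code (monomial-code (∈-bases⁻ i)) p))

  ideal-pure : OrderIdeal.Pure ideal
  ideal-pure {e} {e′} (m , max) (m′ , max′) with ∈-map⁻ monomial m | ∈-map⁻ monomial m′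
  ... | A , a , refl | B , b , refl = pure exch 𝓑ᶠ? (basis-bits (∈-bases⁻ a)) (basis-bits (∈-bases⁻ b))
    (monomial-code (∈-bases⁻ a)) (monomial-code (∈-bases⁻ b))
    (λ c p → max (code⇒monomial c) p) (λ c p → max′ (code⇒monomial c) p)

  module _ {B : Subset n} (b : Basis B) where

    passive : ℕ → Bool
    passive = bits (Vec.tabulate (does ∘ passive? M B))

    passive-does : ∀ x → passive (toℕ x) ≡ does (passive? M B x)
    passive-does x = trans (bits-lookup (Vec.tabulate (does ∘ passive? M B)) x)
                           (lookup∘tabulate (does ∘ passive? M B) x)

    swap-basis : ∀ x y → subset n (swap (bits B) (toℕ x) (toℕ y)) ≡ (B - x) ∪ ⁅ y ⁆
    swap-basis x y = trans (subset-swap (bits B) x y) (cong (λ A → (A - x) ∪ ⁅ y ⁆) (subset-bits B))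

    passive⇒passiveᶠ : ∀ x → passive (toℕ x) ≡ true → bits B (toℕ x) ≡ true × Passiveᶠ (bits B) (toℕ x)
    passive⇒passiveᶠ x eq with does⇒ (passive? M B x) (trans (sym (passive-does x)) eq)
    ... | x∈B , y , y<x , b′ = bx ,
      passive-by exch (toℕ<n x) (basis-bits b)
        (basis⇒𝓑 M pos _ (subst Basis (sym (swap-basis x y)) b′))
        (λ x<z → swap-other (bits B) (<⇒≢ x<z ∘ sym) (<⇒≢ (<-trans y<x x<z) ∘ sym))
        bx (swap-out (bits B) (<⇒≢ y<x ∘ sym))
      where
      bx : bits B (toℕ x) ≡ true
      bx = trans (bits-lookup B x) ([]=⇒lookup x∈B)

    passiveᶠ⇒passive : ∀ x → bits B (toℕ x) ≡ true → Passiveᶠ (bits B) (toℕ x) → passive (toℕ x) ≡ true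
    passiveᶠ⇒passive x bx (z , z<x , _ , b′) = trans (passive-does x) (dec-true (passive? M B x)
      (lookup⇒[]= x B (trans (sym (bits-lookup B x)) bx) , fromℕ< z<n ,
       subst (_< toℕ x) (sym (toℕ-fromℕ< z<n)) z<x ,
       subst Basis (trans (cong (λ z → subset n (swap (bits B) (toℕ x) z)) (sym (toℕ-fromℕ< z<n)))
                          (swap-basis x (fromℕ< z<n)))
             (𝓑⇒basis M pos _ b′)))
      where
      z<n : z < n
      z<n = <-trans z<x (toℕ<n x)

    at-position : ∀ {P : ℕ → Set} → (∀ (x : Fin n) → P (toℕ x)) → ∀ {i} → i < n → P i
    at-position {P} p i<n = subst P (toℕ-fromℕ< i<n) (p (fromℕ< i<n))

    degree-passive : degree (monomial B) ≡ count passive n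
    degree-passive = trans (sym (+-identityʳ _))
      (degree-count exch (basis-bits b) (at-position passive⇒passiveᶠ) (at-position passiveᶠ⇒passive)
                    n ≤-refl above-top (monomial-code b))

    degree-passivity : degree (monomial B) ≡ passivity M B
    degree-passivity = trans degree-passive
      (sym (count-filter (passive? M B) id passive (sym ∘ passive-does)))

    degree-≤-rank : degree (monomial B) ≤ rank
    degree-≤-rank = begin
      degree (monomial B)                ≡⟨ degree-passive ⟩
      count passive n                    ≤⟨ count-≤ n (at-position (λ x → proj₁ ∘ passive⇒passiveᶠ x)) ⟩
      count (bits B) n                   ≡⟨ basis-count (basis-bits b) (basis-bits (proj₂ nonempty)) ⟩
      count (bits (proj₁ nonempty)) n    ≡⟨ count-size (proj₁ nonempty) ⟩
      rank                               ∎
      where open ≤-Reasoning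

  open OrderIdeal ideal using (monomials; maxDegree; oSequence; f)

  h-vector : hVector M ≈₀ oSequence
  h-vector = 0 , rank ∸ maxDegree , trans (++-identityʳ (hVector M))
    (applyUpTo-padded (h M) f (suc maxDegree) (suc rank)
      (s≤s (maximum-≤ degree monomials bounded))
      (λ i → sym (filter-map-length monomial degree (passivity M) i bases
                                    (λ m → degree-passivity (∈-bases⁻ m))))
      (λ i D<i → filter-empty degree i monomials (λ m → ≤-<-trans (≤-maximum degree m) D<i)))
    where
    bounded : ∀ {e} → e ∈ˡ monomials → degree e ≤ rank
    bounded m with ∈-map⁻ monomial m
    ... | B , i , refl = degree-≤-rank (∈-bases⁻ i)

corollary3p7 : (n : ℕ) (M : Matroid n) → IsPositroid M → IsPureOSequence (hVector M)
corollary3p7 n M (L , pos) = n , ideal , ideal-pure , h-vector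
  where open Ideal L M pos
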